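{- Let $C$ be a cycle code with Tanner graph $G = (X \cup U, E)$ and fundamental polytope $\mathcal{P}$. If $\omega \in \mathcal{P}$ is a linear programming pseudocodeword of $\mathcal{P}$ (i.e., an extreme point of $\mathcal{P}$), then the following two conditions hold: (a) $\omega \in \{0,\tfrac12,1\}^{|X|}$, and (b) with $\mathcal{H} := \{x \in X \mid \omega_x = \tfrac12\}$, the subgraph $\Gamma$ of $G$ induced by $\mathcal{H} \cup N(\mathcal{H})$ is 2-regular. Equivalently, $\Gamma$ is a union of vertex-disjoint simple cycles $\gamma_1, \gamma_2, \dots, \gamma_\ell$.
   Context: A code is a binary linear code equipped with a fixed parity-check matrix $H$ (a binary matrix); it is a cycle code if every column of $H$ has exactly two entries equal to 1. The Tanner graph $G=(X\cup U,E)$ of the code is the bipartite graph whose variable nodes $X$ are the columns of $H$ and whose check nodes $U$ are the rows of $H$, with $x\in X$ adjacent to $u\in U$ iff $h_{u,x}=1$. $N(v)$ is the neighborhood of a node $v$ in $G$, and $N(A)=\bigcup_{v\in A}N(v)$ for a set $A$ of nodes. The fundamental polytope $\mathcal{P}=\mathcal{P}(H)$ is the set of all $f\in\mathbb{R}^{|X|}$ (coordinates indexed by $X$) satisfying $0\le f_x\le 1$ for all $x\in X$, and $\sum_{x\in S} f_x+\sum_{x\in N(u)\setminus S}(1-f_x)\le |N(u)|-1$ for all $u\in U$ and all $S\subseteq N(u)$ with $|S|$ odd. A linear programming pseudocodeword is an extreme point of $\mathcal{P}$. A graph is 2-regular if every vertex has degree exactly 2; the empty graph (the case $\mathcal{H}=\emptyset$,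 $\ell=0$) counts as 2-regular. -}

module Defs where

open import Level using (Level; _⊔_; 0ℓ) renaming (suc to lsuc)
open import Data.Bool.Base using (Bool; true; if_then_else_)
open import Data.Empty using (⊥; ⊥-elim)
open import Data.Fin.Base using (Fin; toℕ)
open import Data.Fin.Subset using (Subset; ∣_∣; _⊆_; _─_)
open import Data.Nat.Base as ℕ using (ℕ; suc; parity)
open import Data.Nat.DivMod using (_mod_)
open import Data.Parity.Base using (1ℙ)
open import Data.Product.Base using (Σ-syntax; ∃-syntax; _×_; _,_; proj₁)
open import Data.Sum.Base using (_⊎_; inj₁; inj₂)
open import Data.Vec.Base using (lookup; tabulate)
open import Function.Bundles using (_⇔_)
open import Function.Definitions using (Injective)
open import Relation.Binary.Core using (Rel)
open import Relation.Binary.PropositionalEquality.Core using (_≡_)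
open import Relation.Binary.Structures using (IsStrictPartialOrder)
open import Relation.Nullary.Negation.Core using (¬_)
open import Relation.Unary using (Pred; _∪_)
open import Algebra.Apartness.Bundles using (HeytingField)
open import Algebra.Bundles using (CommutativeRing)
import Algebra.Apartness.Properties.HeytingCommutativeRing as HeytingProperties
import Algebra.Definitions.RawMonoid as RawMonoidDefinitions
import Algebra.Properties.Ring as RingProperties
import Relation.Binary.Reasoning.Setoid as SetoidReasoning

-- The library has no real numbers, so ℝ is axiomatised as a Cauchy-complete
-- Archimedean ordered field, which determines it up to isomorphism.  The
-- order axioms are the constructive ones: `_<_` is not assumed decidable, so
-- that Bishop's reals satisfy them, as do the reals of classical mathematics
-- (where `x # y` is ¬ x ≈ y).  Cotransitivity of `_<_` follows from that
-- of `_#_`.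

record RealNumbers c ℓ₁ ℓ₂ : Set (lsuc (c ⊔ ℓ₁ ⊔ ℓ₂)) where
  field
    heytingField : HeytingField c ℓ₁ ℓ₂

  open HeytingField heytingField public

  commutativeRing : CommutativeRing c ℓ₁
  commutativeRing = record { isCommutativeRing = isCommutativeRing }

  open CommutativeRing commutativeRing public using (+-rawMonoid)

  open RawMonoidDefinitions +-rawMonoid public
    using (sum) renaming (_×_ to _·_)

  infix 4 _<_ _≤_

  field
    _<_                  : Rel Carrier ℓ₂
    isStrictPartialOrder : IsStrictPartialOrder _≈_ _<_
    <⇒#                  : ∀ {x y} → x < y → x # y
    #⇒<⊎>                : ∀ {x y} → x # y → x < y ⊎ y < x
    +-monoˡ-<            : ∀ z {x y} → x < y → x + z < y + z
    *-pos                : ∀ {x y} → 0# < x → 0# < y → 0# < x * y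

  _≤_ : Rel Carrier ℓ₂
  x ≤ y = ¬ (y < x)

  -- ∣ x - y ∣ < ε
  Within : Carrier → Carrier → Carrier → Set ℓ₂
  Within ε x y = x - y < ε × y - x < ε

  IsCauchy : (ℕ → Carrier) → Set (c ⊔ ℓ₂)
  IsCauchy s = ∀ ε → 0# < ε →
    ∃[ N ] ∀ i j → N ℕ.≤ i → N ℕ.≤ j → Within ε (s i) (s j)

  _ConvergesTo_ : (ℕ → Carrier) → Carrier → Set (c ⊔ ℓ₂)
  s ConvergesTo l = ∀ ε → 0# < ε →
    ∃[ N ] ∀ i → N ℕ.≤ i → Within ε (s i) l

  field
    archimedean : ∀ x → ∃[ n ] x < n · 1#
    complete    : ∀ s → IsCauchy s → ∃[ l ] s ConvergesTo l

  private
    open CommutativeRing commutativeRing using (ring)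
    open RingProperties ring using (-‿distribˡ-*; -‿involutive)
    open HeytingProperties heytingCommutativeRing using (1#0)
    module < = IsStrictPartialOrder isStrictPartialOrder

    -1*-1≈1 : (- 1#) * (- 1#) ≈ 1#
    -1*-1≈1 = begin
      (- 1#) * (- 1#)   ≈⟨ -‿distribˡ-* 1# (- 1#) ⟨
      - (1# * (- 1#))   ≈⟨ -‿cong (*-identityˡ (- 1#)) ⟩
      - (- 1#)          ≈⟨ -‿involutive 1# ⟩
      1#                ∎
      where open SetoidReasoning (CommutativeRing.setoid commutativeRing)

  0<1 : 0# < 1#
  0<1 with #⇒<⊎> 1#0
  ... | inj₂ 0<1 = 0<1
  ... | inj₁ 1<0 = ⊥-elim (<.asym 1<0 (<.<-respʳ-≈ -1*-1≈1 (*-pos 0<-1 0<-1)))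
    where
    0<-1 : 0# < - 1#
    0<-1 = <.<-respˡ-≈ (-‿inverseʳ 1#)
             (<.<-respʳ-≈ (+-identityˡ (- 1#)) (+-monoˡ-< (- 1#) 1<0))

  0<2 : 0# < 1# + 1#
  0<2 = <.trans 0<1 (<.<-respˡ-≈ (+-identityˡ 1#) (+-monoˡ-< 1# 0<1))

  -- `#⇒invertible` inverts differences, hence the `- 0#` hidden in its type:
  -- ½ is the inverse of (1# + 1#) - 0#.
  ½ : Carrier
  ½ = proj₁ (#⇒invertible (HeytingField.#-sym heytingField (<⇒# 0<2)))

-- A code is given by its parity-check matrix H, with rows U and columns X;
-- its codewords (the null space of H over 𝔽₂) are determined by H.
record Code : Set where
  field
    ∣X∣ ∣U∣ : ℕ
    H       : Fin ∣U∣ → Fin ∣X∣ → Bool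

  X U : Set
  X = Fin ∣X∣
  U = Fin ∣U∣

  row : U → Subset ∣X∣
  row u = tabulate (λ x → H u x)

  column : X → Subset ∣U∣
  column x = tabulate (λ u → H u x)

IsCycleCode : Code → Set
IsCycleCode C = ∀ x → ∣ column x ∣ ≡ 2
  where open Code C

-- Simple graphs whose vertices form a subset of an ambient type A.
record Graph (A : Set) (ℓ : Level) : Set (lsuc ℓ) where
  field
    Vertex : Pred A ℓ
    Adj    : Rel A ℓ

module _ {A : Set} where

  neighborhood : ∀ {ℓ} → Graph A ℓ → A → Pred A ℓ
  neighborhood G v w = Graph.Adj G v w

  neighborhoodOf : ∀ {ℓ ℓ′} → Graph A ℓ → Pred A ℓ′ → Pred A (ℓ ⊔ ℓ′)
  neighborhoodOf G S w = ∃[ v ] S v × neighborhood G v w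

  induced : ∀ {ℓ ℓ′} → Graph A ℓ → Pred A ℓ′ → Graph A (ℓ ⊔ ℓ′)
  induced G W = record
    { Vertex = λ v → Graph.Vertex G v × W v
    ; Adj    = λ v w → W v × W w × Graph.Adj G v w
    }

  HasCardinality : ∀ {ℓ} → Pred A ℓ → ℕ → Set ℓ
  HasCardinality S k =
    Σ[ f ∈ (Fin k → A) ] Injective _≡_ _≡_ f × (∀ a → S a ⇔ (∃[ i ] a ≡ f i))

  2-Regular : ∀ {ℓ} → Graph A ℓ → Set ℓ
  2-Regular G = ∀ v → Graph.Vertex G v → HasCardinality (neighborhood G v) 2

record SimpleCycle (A : Set) : Set where
  field
    length-3 : ℕ

  length : ℕ
  length = 3 ℕ.+ length-3

  field
    node           : Fin length → A
    node-injective : Injective _≡_ _≡_ node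

  next : Fin length → Fin length
  next i = suc (toℕ i) mod length

  OnCycle : Pred A 0ℓ
  OnCycle v = ∃[ i ] v ≡ node i

  CycleEdge : Rel A 0ℓ
  CycleEdge v w = ∃[ i ]
    ((v ≡ node i × w ≡ node (next i)) ⊎ (w ≡ node i × v ≡ node (next i)))

open SimpleCycle using (OnCycle; CycleEdge)

record IsDisjointUnionOfCycles {A : Set} {ℓ} (G : Graph A ℓ) : Set ℓ where
  field
    number   : ℕ
    cycle    : Fin number → SimpleCycle A
    vertices : ∀ v → Graph.Vertex G v ⇔ (∃[ i ] OnCycle (cycle i) v)
    edges    : ∀ v w → Graph.Adj G v w ⇔ (∃[ i ] CycleEdge (cycle i) v w)
    disjoint : ∀ i j v → OnCycle (cycle i) v → OnCycle (cycle j) v → i ≡ j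

module _ (C : Code) where
  open Code C

  Node : Set
  Node = X ⊎ U

  data TannerAdj : Rel Node 0ℓ where
    x~u : ∀ {x u} → H u x ≡ true → TannerAdj (inj₁ x) (inj₂ u)
    u~x : ∀ {x u} → H u x ≡ true → TannerAdj (inj₂ u) (inj₁ x)

  data IsNode : Pred Node 0ℓ where
    isNode : ∀ {v} → IsNode v

  tannerGraph : Graph Node 0ℓ
  tannerGraph = record { Vertex = IsNode ; Adj = TannerAdj }

module _ {c ℓ₁ ℓ₂} (ℝ : RealNumbers c ℓ₁ ℓ₂) where
  open RealNumbers ℝ

  Is0½1 : Pred Carrier ℓ₁
  Is0½1 a = a ≈ 0# ⊎ a ≈ ½ ⊎ a ≈ 1#

  Point : ℕ → Set c
  Point n = Fin n → Carrier

  sumOver : ∀ {n} → Subset n → Point n → Carrier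
  sumOver S f = sum (λ x → if lookup S x then f x else 0#)

  IsExtremePoint : ∀ {n ℓ} → Pred (Point n) ℓ → Pred (Point n) (c ⊔ ℓ₁ ⊔ ℓ₂ ⊔ ℓ)
  IsExtremePoint P ω = P ω ×
    (∀ y z t → P y → P z → 0# < t → t < 1# →
      (∀ x → ω x ≈ t * y x + (1# - t) * z x) →
      ∀ x → y x ≈ z x)

  module _ (C : Code) where
    open Code C

    -- `row u` is N(u) as a subset of X.
    record FundamentalPolytope (f : Point ∣X∣) : Set ℓ₂ where
      field
        lower : ∀ x → 0# ≤ f x
        upper : ∀ x → f x ≤ 1#
        check : ∀ u (S : Subset ∣X∣) → S ⊆ row u → parity ∣ S ∣ ≡ 1ℙ →
                sumOver S f + sumOver (row u ─ S) (λ x → 1# - f x)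
                  ≤ ∣ row u ∣ · 1# - 1#

    IsLPPseudocodeword : Pred (Point ∣X∣) (c ⊔ ℓ₁ ⊔ ℓ₂)
    IsLPPseudocodeword = IsExtremePoint FundamentalPolytope

    halfNodes : Point ∣X∣ → Pred (Node C) ℓ₁
    halfNodes ω v = ∃[ x ] v ≡ inj₁ x × ω x ≈ ½

    Γ : Point ∣X∣ → Graph (Node C) ℓ₁
    Γ ω = induced (tannerGraph C)
            (halfNodes ω ∪ neighborhoodOf (tannerGraph C) (halfNodes ω))

{-# OPTIONS --safe #-}
module Submission where

-- View the checks as the vertices and the variables as the edges of a graph,
-- and call an edge fractional if 0 < ω x < 1.  No check meets exactly one
-- fractional edge.  At a check u, two tight inequalities given by S and S′
-- force every fractional edge at u into S △ S′, so on the fractional edges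
-- their normals are opposite: each check imposes at most one linear condition
-- on directions supported there.  If some check met more than two fractional
-- edges, there would be more fractional edges than checks meeting them, hence
-- a nonzero direction along which ω moves both ways inside the polytope.  So
-- every check meets zero or two fractional edges, and then 2ω - 1 on the
-- fractional edges is such a direction; it must vanish, that is, ω = ½ there.
--
-- The order of ℝ is not decidable.  The argument is carried out under double
-- negations, which are removed at the end because ≈ is stable and 0, ½, 1 are
-- apart.

-- Counting dimensions cannot finish the proof. Once every touched check has two fractional edges,
-- there may be as many conditions as unknowns, and then nothing forces a nonzero solution; an
-- explicit direction is needed. In coordinates centred at ½, a tight inequality at such a check
-- says that two coordinates agree up to sign. This is homogeneous, so the centred point itself
-- solves it, and rigidity at an extreme point sends it to the centre: this is where the value ½
-- comes from.
--
-- Neither tightness of an inequality nor the class of a coordinate can be decided, yet one step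
-- length must serve all inequalities. Finiteness settles both: double negation commutes with finite
-- quantifiers, and finitely many thresholds have a maximum. The classification of the coordinates
-- as 0, 1 or fractional is a parameter of the argument, which is used twice: under a double
-- negation to obtain half-integrality, and then with the classification that half-integrality
-- supplies, to build Γ and its cycles as data.

open import Defs
open import Level using (Level; _⊔_)
open import Algebra.Bundles using (CommutativeRing)
import Algebra.Apartness.Properties.HeytingCommutativeRing as HeytingProperties
import Algebra.Properties.Ring as RingProperties
import Algebra.Properties.Semiring.Mult.TCOptimised as SemiringMult′
import Algebra.Properties.Semiring.Sum as SemiringSum
import Algebra.Solver.Ring as RingSolver
import Algebra.Solver.Ring.AlmostCommutativeRing as ACR
open import Data.Bool.Base using (Bool; true; false; if_then_else_; _xor_; _∧_; not)
import Data.Bool.Properties as Bool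
open import Data.Empty using (⊥; ⊥-elim)
open import Data.Fin.Base using (Fin; zero; suc; toℕ; fromℕ<; splitAt; join)
open import Data.Fin.Properties
  using (_≟_; toℕ-fromℕ<; toℕ<n; toℕ-injective; pigeonhole; any?; splitAt-join)
open import Data.Fin.Subset using (Subset; ∣_∣; _∩_; _─_)
open import Data.Integer.Base as ℤ using (ℤ; +_; -[1+_]; _⊖_)
import Data.Integer.Properties as ℤ
open import Data.List.Base as List using (List)
open import Data.List.Membership.Propositional using (_∈_)
open import Data.List.Membership.Propositional.Properties using (∈-tabulate⁺)
open import Data.List.Relation.Unary.Any using (here; there)
open import Data.Maybe.Base using (Maybe; just; nothing)
open import Data.Nat.Base as ℕ using (ℕ; zero; suc; parity; z≤n; s≤s; z<s; s<s; s<s⁻¹)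
open import Data.Nat.DivMod using (m<n⇒m%n≡m; n%n≡0; m%n<n)
import Data.Nat.Properties as ℕ
open import Data.Parity.Base as ℙ using (0ℙ; 1ℙ)
import Data.Parity.Properties as ℙ
open import Data.Product.Base using (_×_; _,_; proj₁; proj₂; ∃; ∃-syntax)
open import Data.Sum.Base as Sum using (_⊎_; inj₁; inj₂)
import Data.Sum.Properties as Sum
open import Data.Vec.Base using ([]; _∷_; lookup; tabulate; zipWith; _[_]≔_)
open import Data.Vec.Properties
  using (lookup∘tabulate; tabulate∘lookup; tabulate-cong; lookup-zipWith;
         lookup∘update; lookup∘update′; lookup⇒[]=; []=⇒lookup)
open import Function.Base using (_∘_)
open import Function.Bundles using (mk⇔; Equivalence)
open import Relation.Binary.Definitions using (DecidableEquality; Symmetric; tri<; tri≈; tri>)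
open import Relation.Binary.PropositionalEquality.Core as ≡ using (_≡_; _≢_; cong; cong₂; subst)
open import Relation.Binary.PropositionalEquality.Properties using (module ≡-Reasoning)
import Relation.Binary.Reasoning.Setoid as SetoidReasoning
open import Relation.Binary.Structures using (IsStrictPartialOrder)
open import Relation.Nullary using (¬_; Dec; yes; no; does; contradiction; ¬¬-excluded-middle)
open import Relation.Nullary.Decidable using (map′; _×-dec_)
open import Relation.Unary using (Pred)

open SimpleCycle using (OnCycle; CycleEdge; node; next)
open SemiringSum ℕ.+-*-semiring using () renaming
  ( sum to sumℕ; ∑-comm to sumℕ-comm; sum-cong-≗ to sumℕ-cong
  ; *-distribˡ-sum to *-distribˡ-sumℕ; sum-replicate-zero to sumℕ-zero )

-- Ring identities with integer coefficients

module IntegerSolver {c ℓ} (R : CommutativeRing c ℓ) where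
  open CommutativeRing R
  open RingProperties ring
  open SemiringMult′ semiring using (1+×; ×1-homo-*; ×-homo-+) renaming (_×_ to _×′_)
  open SetoidReasoning setoid
  open import Algebra.Solver.CommutativeMonoid +-commutativeMonoid
    using (_⊕_; _⊜_) renaming (solve to +-solve)

  -- With the optimised multiple the literals 0, 1 and 2 unfold to `0#`, `1#` and `1# + 1#`, so
  -- goals match solver equations definitionally.
  ⟦_⟧ℤ : ℤ → Carrier
  ⟦ + n ⟧ℤ      = n ×′ 1#
  ⟦ -[1+ n ] ⟧ℤ = - (suc n ×′ 1#)

  ⊖-homo : ∀ m n → ⟦ m ⊖ n ⟧ℤ ≈ m ×′ 1# - n ×′ 1#
  ⊖-homo m zero = begin
    m ×′ 1#       ≈⟨ +-identityʳ _ ⟨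
    m ×′ 1# + 0#  ≈⟨ +-congˡ -0#≈0# ⟨
    m ×′ 1# - 0#  ∎
  ⊖-homo zero (suc n) = sym (+-identityˡ _)
  ⊖-homo (suc m) (suc n) = begin
    ⟦ suc m ⊖ suc n ⟧ℤ                 ≡⟨ ≡.cong ⟦_⟧ℤ (ℤ.[1+m]⊖[1+n]≡m⊖n m n) ⟩
    ⟦ m ⊖ n ⟧ℤ                         ≈⟨ ⊖-homo m n ⟩
    m ×′ 1# - n ×′ 1#                  ≈⟨ +-identityˡ _ ⟨
    0# + (m ×′ 1# - n ×′ 1#)           ≈⟨ +-congʳ (-‿inverseʳ 1#) ⟨
    (1# - 1#) + (m ×′ 1# - n ×′ 1#)    ≈⟨ +-solve 4 (λ a b x y → (a ⊕ b) ⊕ (x ⊕ y) ⊜ (a ⊕ x) ⊕ (b ⊕ y))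
                                            refl 1# (- 1#) (m ×′ 1#) (- (n ×′ 1#)) ⟩
    (1# + m ×′ 1#) + (- 1# - n ×′ 1#)  ≈⟨ +-congˡ (-‿+-comm _ _) ⟩
    (1# + m ×′ 1#) - (1# + n ×′ 1#)    ≈⟨ +-cong (1+× m 1#) (-‿cong (1+× n 1#)) ⟨
    suc m ×′ 1# - suc n ×′ 1#          ∎

  +-homo : ∀ i j → ⟦ i ℤ.+ j ⟧ℤ ≈ ⟦ i ⟧ℤ + ⟦ j ⟧ℤ
  +-homo (+ m)    (+ n)    = ×-homo-+ 1# m n
  +-homo (+ m)    -[1+ n ] = ⊖-homo m (suc n)
  +-homo -[1+ m ] (+ n)    = trans (⊖-homo n (suc m)) (+-comm _ _)
  +-homo -[1+ m ] -[1+ n ] = begin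
    - (suc (suc (m ℕ.+ n)) ×′ 1#)        ≡⟨ ≡.cong (λ k → - (suc k ×′ 1#)) (ℕ.+-suc m n) ⟨
    - ((suc m ℕ.+ suc n) ×′ 1#)          ≈⟨ -‿cong (×-homo-+ 1# (suc m) (suc n)) ⟩
    - (suc m ×′ 1# + suc n ×′ 1#)        ≈⟨ -‿+-comm _ _ ⟨
    - (suc m ×′ 1#) - (suc n ×′ 1#)      ∎

  -‿homo : ∀ i → ⟦ ℤ.- i ⟧ℤ ≈ - ⟦ i ⟧ℤ
  -‿homo (+ zero)  = sym -0#≈0#
  -‿homo (+ suc n) = refl
  -‿homo -[1+ n ]  = sym (-‿involutive _)

  *-homo-+ : ∀ m j → ⟦ + m ℤ.* j ⟧ℤ ≈ m ×′ 1# * ⟦ j ⟧ℤ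
  *-homo-+ m (+ n) = trans (reflexive (≡.cong ⟦_⟧ℤ (≡.sym (ℤ.pos-* m n)))) (×1-homo-* m n)
  *-homo-+ m -[1+ n ] = begin
    ⟦ + m ℤ.* -[1+ n ] ⟧ℤ         ≡⟨ ≡.cong ⟦_⟧ℤ (ℤ.neg-distribʳ-* (+ m) (+ suc n)) ⟨
    ⟦ ℤ.- (+ m ℤ.* + suc n) ⟧ℤ    ≈⟨ -‿homo (+ m ℤ.* + suc n) ⟩
    - ⟦ + m ℤ.* + suc n ⟧ℤ        ≈⟨ -‿cong (*-homo-+ m (+ suc n)) ⟩
    - (m ×′ 1# * suc n ×′ 1#)     ≈⟨ -‿distribʳ-* _ _ ⟩
    m ×′ 1# * - (suc n ×′ 1#)     ∎

  *-homo : ∀ i j → ⟦ i ℤ.* j ⟧ℤ ≈ ⟦ i ⟧ℤ * ⟦ j ⟧ℤ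
  *-homo (+ m) j = *-homo-+ m j
  *-homo -[1+ m ] j = begin
    ⟦ -[1+ m ] ℤ.* j ⟧ℤ           ≡⟨ ≡.cong ⟦_⟧ℤ (ℤ.neg-distribˡ-* (+ suc m) j) ⟨
    ⟦ ℤ.- (+ suc m ℤ.* j) ⟧ℤ      ≈⟨ -‿homo (+ suc m ℤ.* j) ⟩
    - ⟦ + suc m ℤ.* j ⟧ℤ          ≈⟨ -‿cong (*-homo-+ (suc m) j) ⟩
    - (suc m ×′ 1# * ⟦ j ⟧ℤ)      ≈⟨ -‿distribˡ-* _ _ ⟩
    - (suc m ×′ 1#) * ⟦ j ⟧ℤ      ∎

  ℤ⟶R : CommutativeRing.rawRing ℤ.+-*-commutativeRing ACR.-Raw-AlmostCommutative⟶ ACR.fromCommutativeRing R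
  ℤ⟶R = record
    { ⟦_⟧    = ⟦_⟧ℤ
    ; +-homo = +-homo
    ; *-homo = *-homo
    ; -‿homo = -‿homo
    ; 0-homo = refl
    ; 1-homo = refl
    }

  -- Equality in `R` need not be decidable; deciding it for integer coefficients is enough to
  -- recognise cancelling terms.
  _coeff≟_ : ∀ i j → Maybe (⟦ i ⟧ℤ ≈ ⟦ j ⟧ℤ)
  i coeff≟ j with i ℤ.≟ j
  ... | yes i≡j = just (reflexive (≡.cong ⟦_⟧ℤ i≡j))
  ... | no  _   = nothing

  open RingSolver _ (ACR.fromCommutativeRing R) ℤ⟶R _coeff≟_ public
    using (solve; con; _:=_; _:+_; _:*_; _:-_; :-_)

-- Double negation and eventual properties over finite index sets

Eventually : ∀ {ℓ} → (ℕ → Set ℓ) → Set ℓ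
Eventually P = ∃[ N ] ∀ n → N ℕ.≤ n → P n

eventually-× : ∀ {p q} {P : ℕ → Set p} {Q : ℕ → Set q} →
               Eventually P → Eventually Q → Eventually (λ n → P n × Q n)
eventually-× (M , p) (N , q) = M ℕ.⊔ N , λ n M⊔N≤n →
  p n (ℕ.≤-trans (ℕ.m≤m⊔n M N) M⊔N≤n) , q n (ℕ.≤-trans (ℕ.m≤n⊔m M N) M⊔N≤n)

eventually-map : ∀ {p q} {P : ℕ → Set p} {Q : ℕ → Set q} →
                 (∀ n → P n → Q n) → Eventually P → Eventually Q
eventually-map f (N , p) = N , λ n N≤n → f n (p n N≤n)

eventually-Fin : ∀ {k p} {P : Fin k → ℕ → Set p} →
                 (∀ i → Eventually (P i)) → Eventually (λ n → ∀ i → P i n)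
eventually-Fin {zero}  ev = 0 , λ _ _ ()
eventually-Fin {suc k} ev = eventually-map (λ { n (p₀ , p) zero → p₀ ; n (p₀ , p) (suc i) → p i })
  (eventually-× (ev zero) (eventually-Fin (ev ∘ suc)))

eventually-Subset : ∀ {k p} {P : Subset k → ℕ → Set p} →
                    (∀ S → Eventually (P S)) → Eventually (λ n → ∀ S → P S n)
eventually-Subset {zero}  ev = eventually-map (λ { n p [] → p }) (ev [])
eventually-Subset {suc k} ev =
  eventually-map (λ { n (p , q) (true ∷ S) → p S ; n (p , q) (false ∷ S) → q S })
    (eventually-× (eventually-Subset (λ S → ev (true ∷ S))) (eventually-Subset (λ S → ev (false ∷ S))))

¬¬-Fin : ∀ {k p} {P : Fin k → Set p} → (∀ i → ¬ ¬ P i) → ¬ ¬ (∀ i → P i)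
¬¬-Fin {zero}  ¬¬P ¬∀ = ¬∀ λ ()
¬¬-Fin {suc k} ¬¬P ¬∀ = ¬¬P zero λ p₀ → ¬¬-Fin (¬¬P ∘ suc) λ p →
  ¬∀ λ { zero → p₀ ; (suc i) → p i }

¬¬-Subset : ∀ {k p} {P : Subset k → Set p} → (∀ S → ¬ ¬ P S) → ¬ ¬ (∀ S → P S)
¬¬-Subset {zero}  ¬¬P ¬∀ = ¬¬P [] λ p → ¬∀ λ { [] → p }
¬¬-Subset {suc k} ¬¬P ¬∀ =
  ¬¬-Subset (λ S → ¬¬P (true ∷ S)) λ p → ¬¬-Subset (λ S → ¬¬P (false ∷ S)) λ q →
  ¬∀ λ { (true ∷ S) → p S ; (false ∷ S) → q S }

-- Ordered field arithmetic

module Reals {c ℓ₁ ℓ₂} (ℝ : RealNumbers c ℓ₁ ℓ₂) where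
  open RealNumbers ℝ public hiding (zero)
  open CommutativeRing commutativeRing public using (ring; semiring)
  open RingProperties ring public using (-0#≈0#)
  open IntegerSolver commutativeRing public using (solve; con; _:=_; _:+_; _:*_; _:-_; :-_)
  open SemiringSum semiring public
    using (sum-cong-≋; ∑-distrib-+; *-distribˡ-sum; sum-replicate-zero)
  open HeytingProperties heytingCommutativeRing public using (x-0≈x; 1#0; x#0y#0→xy#0)
  open IsStrictPartialOrder isStrictPartialOrder public
    using (<-respʳ-≈; <-respˡ-≈) renaming (trans to <-trans; irrefl to <-irrefl; asym to <-asym)

  <-cotrans : ∀ {x y} → x < y → ∀ z → x < z ⊎ z < y
  <-cotrans x<y z with #-cotrans (<⇒# x<y) z
  ... | inj₁ x#z with #⇒<⊎> x#z
  ...   | inj₁ x<z = inj₁ x<z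
  ...   | inj₂ z<x = inj₂ (<-trans z<x x<y)
  <-cotrans x<y z | inj₂ z#y with #⇒<⊎> z#y
  ...   | inj₁ z<y = inj₂ z<y
  ...   | inj₂ y<z = inj₁ (<-trans x<y y<z)

  -- Tightness makes equality the negation of apartness, and negations are stable. This is the way
  -- out of the double negations.
  ≈-stable : ∀ {x y} → ¬ ¬ (x ≈ y) → x ≈ y
  ≈-stable ¬¬x≈y = proj₁ (tight _ _) λ x#y → ¬¬x≈y λ x≈y → proj₂ (tight _ _) x≈y x#y

  ≤-antisym : ∀ {x y} → x ≤ y → y ≤ x → x ≈ y
  ≤-antisym x≤y y≤x = proj₁ (tight _ _) λ x#y → case (#⇒<⊎> x#y)
    where
    case : _ → _
    case (inj₁ x<y) = y≤x x<y
    case (inj₂ y<x) = x≤y y<x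

  ≤-reflexive : ∀ {x y} → x ≈ y → x ≤ y
  ≤-reflexive x≈y y<x = <-irrefl (sym x≈y) y<x

  <⇒≤ : ∀ {x y} → x < y → x ≤ y
  <⇒≤ = <-asym

  <-≤-trans : ∀ {x y z} → x < y → y ≤ z → x < z
  <-≤-trans {z = z} x<y y≤z with <-cotrans x<y z
  ... | inj₁ x<z = x<z
  ... | inj₂ z<y = contradiction z<y y≤z

  ≤-<-trans : ∀ {x y z} → x ≤ y → y < z → x < z
  ≤-<-trans {x} x≤y y<z with <-cotrans y<z x
  ... | inj₁ y<x = contradiction y<x x≤y
  ... | inj₂ x<z = x<z

  ≤-trans : ∀ {x y z} → x ≤ y → y ≤ z → x ≤ z
  ≤-trans x≤y y≤z z<x = y≤z (<-≤-trans z<x x≤y)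

  ≤-respˡ : ∀ {x y z} → x ≈ y → x ≤ z → y ≤ z
  ≤-respˡ x≈y x≤z z<y = x≤z (<-respʳ-≈ (sym x≈y) z<y)

  ≤-respʳ : ∀ {x y z} → x ≈ y → z ≤ x → z ≤ y
  ≤-respʳ x≈y z≤x y<z = z≤x (<-respˡ-≈ (sym x≈y) y<z)

  +-monoʳ-< : ∀ z {x y} → x < y → z + x < z + y
  +-monoʳ-< z x<y = <-respˡ-≈ (+-comm _ z) (<-respʳ-≈ (+-comm _ z) (+-monoˡ-< z x<y))

  +-cancelʳ-< : ∀ z {x y} → x + z < y + z → x < y
  +-cancelʳ-< z {x} {y} p = <-respˡ-≈ (cancel x) (<-respʳ-≈ (cancel y) (+-monoˡ-< (- z) p))
    where
    cancel : ∀ w → w + z - z ≈ w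
    cancel w = solve 2 (λ w z → w :+ z :- z := w) refl w z

  +-monoˡ-≤ : ∀ z {x y} → x ≤ y → x + z ≤ y + z
  +-monoˡ-≤ z x≤y y+z<x+z = x≤y (+-cancelʳ-< z y+z<x+z)

  +-monoʳ-≤ : ∀ z {x y} → x ≤ y → z + x ≤ z + y
  +-monoʳ-≤ z x≤y = ≤-respˡ (+-comm _ z) (≤-respʳ (+-comm _ z) (+-monoˡ-≤ z x≤y))

  +-mono-≤ : ∀ {w x y z} → w ≤ x → y ≤ z → w + y ≤ x + z
  +-mono-≤ w≤x y≤z = ≤-trans (+-monoˡ-≤ _ w≤x) (+-monoʳ-≤ _ y≤z)

  +-mono-<-≤ : ∀ {w x y z} → w < x → y ≤ z → w + y < x + z
  +-mono-<-≤ w<x y≤z = <-≤-trans (+-monoˡ-< _ w<x) (+-monoʳ-≤ _ y≤z)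

  +-mono-≤-< : ∀ {w x y z} → w ≤ x → y < z → w + y < x + z
  +-mono-≤-< w≤x y<z = ≤-<-trans (+-monoˡ-≤ _ w≤x) (+-monoʳ-< _ y<z)

  -- Linear inequalities are settled by exhibiting the difference of the two
  -- sides as something positive and leaving the identity to the ring solver.
  <-by : ∀ {x y z} → 0# < z → x + z ≈ y → x < y
  <-by {x} 0<z x+z≈y = <-respˡ-≈ (+-identityʳ x) (<-respʳ-≈ x+z≈y (+-monoʳ-< x 0<z))

  ≤-by : ∀ {x y z} → 0# ≤ z → x + z ≈ y → x ≤ y
  ≤-by {x} 0≤z x+z≈y = ≤-respˡ (+-identityʳ x) (≤-respʳ x+z≈y (+-monoʳ-≤ x 0≤z))

  0<- : ∀ {x y} → x < y → 0# < y - x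
  0<- {x} x<y = <-respˡ-≈ (-‿inverseʳ x) (+-monoˡ-< (- x) x<y)

  0≤- : ∀ {x y} → x ≤ y → 0# ≤ y - x
  0≤- {x} x≤y = ≤-respˡ (-‿inverseʳ x) (+-monoˡ-≤ (- x) x≤y)

  inverse : ∀ {x} → 0# < x → ∃[ y ] y * x ≈ 1# × 0# < y
  inverse {x} 0<x with #⇒invertible (#-sym (<⇒# 0<x))
  ... | y , y[x-0]≈1 , [x-0]y≈1 = y , yx≈1 , 0<y
    where
    yx≈1 : y * x ≈ 1#
    yx≈1 = trans (*-congˡ (sym (x-0≈x x))) y[x-0]≈1

    y#0 : y # 0#
    y#0 = invertible⇒#
      ( x
      , solve-yx
      , trans (*-comm _ x) solve-yx )
      where
      solve-yx : x * (y - 0#) ≈ 1#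
      solve-yx = trans (solve 2 (λ x y → x :* (y :- con (+ 0)) := y :* x) refl x y) yx≈1

    0<y : 0# < y
    0<y with #⇒<⊎> y#0
    ... | inj₂ 0<y = 0<y
    ... | inj₁ y<0 = ⊥-elim (<-asym 0<1 1<0)
      where
      1<0 : 1# < 0#
      1<0 = <-by (*-pos (0<- y<0) 0<x)
        (trans (+-cong (sym yx≈1) refl)
          (solve 2 (λ x y → y :* x :+ (con (+ 0) :- y) :* x := con (+ 0)) refl x y))

  *-cancelˡ-0 : ∀ {x y} → x # 0# → x * y ≈ 0# → y ≈ 0#
  *-cancelˡ-0 {x} {y} x#0 xy≈0 with #⇒invertible x#0
  ... | x⁻¹ , x⁻¹[x-0]≈1 , _ = begin
    y                        ≈⟨ *-identityˡ y ⟨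
    1# * y                   ≈⟨ *-congʳ x⁻¹[x-0]≈1 ⟨
    x⁻¹ * (x - 0#) * y       ≈⟨ *-congʳ (*-congˡ (x-0≈x x)) ⟩
    x⁻¹ * x * y              ≈⟨ *-assoc _ _ _ ⟩
    x⁻¹ * (x * y)            ≈⟨ *-congˡ xy≈0 ⟩
    x⁻¹ * 0#                 ≈⟨ zeroʳ _ ⟩
    0#                       ∎
    where open SetoidReasoning setoid

  private
    double : ∀ h → h * (1# + 1# - 0#) ≈ 1# → h + h ≈ 1#
    double h = trans (solve 1 (λ h → h :+ h := h :* (con (+ 1) :+ con (+ 1) :- con (+ 0))) refl h)

    double-unique : ∀ {x h} → x + x ≈ 1# → h + h ≈ 1# → x ≈ h
    double-unique {x} {h} x+x≈1 h+h≈1 = begin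
      x                 ≈⟨ *-identityʳ x ⟨
      x * 1#            ≈⟨ *-congˡ h+h≈1 ⟨
      x * (h + h)       ≈⟨ solve 2 (λ x h → x :* (h :+ h) := h :* (x :+ x)) refl x h ⟩
      h * (x + x)       ≈⟨ *-congˡ x+x≈1 ⟩
      h * 1#            ≈⟨ *-identityʳ h ⟩
      h                 ∎
      where open SetoidReasoning setoid

    double-pos : ∀ {h} → h + h ≈ 1# → 0# < h
    double-pos {h} h+h≈1 with <-cotrans 0<1 h
    ... | inj₁ 0<h = 0<h
    -- Since `h + h ≈ 1#`, the positive number `1# - h` is `h` itself.
    ... | inj₂ h<1 = <-respʳ-≈ (trans (+-congʳ (sym h+h≈1)) (solve 1 (λ h → h :+ h :- h := h) refl h)) (0<- h<1)

  2½≈1 : ½ + ½ ≈ 1#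
  2½≈1 = double ½ (proj₁ (proj₂ (#⇒invertible (#-sym (<⇒# 0<2)))))

  ≈½ : ∀ {x} → x + x ≈ 1# → x ≈ ½
  ≈½ x+x≈1 = double-unique x+x≈1 2½≈1

  0<½ : 0# < ½
  0<½ = double-pos 2½≈1

  ½<1 : ½ < 1#
  ½<1 = <-by 0<½ 2½≈1

  sum-mono-≤ : ∀ {n} {f g : Fin n → Carrier} → (∀ i → f i ≤ g i) → sum f ≤ sum g
  sum-mono-≤ {zero}  f≤g = ≤-reflexive refl
  sum-mono-≤ {suc n} f≤g = +-mono-≤ (f≤g zero) (sum-mono-≤ (f≤g ∘ suc))

  sum-mono-< : ∀ {n} {f g : Fin n → Carrier} → (∀ i → f i ≤ g i) → ∀ i → f i < g i → sum f < sum g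
  sum-mono-< f≤g zero    f₀<g₀ = +-mono-<-≤ f₀<g₀ (sum-mono-≤ (f≤g ∘ suc))
  sum-mono-< f≤g (suc i) fᵢ<gᵢ = +-mono-≤-< (f≤g zero) (sum-mono-< (f≤g ∘ suc) i fᵢ<gᵢ)

  ·1-< : ∀ {m n} → m ℕ.≤ n → m · 1# < suc n · 1#
  ·1-< {zero} {zero}  ℕ.z≤n = <-respʳ-≈ (sym (+-identityʳ 1#)) 0<1
  ·1-< {zero} {suc n} ℕ.z≤n = <-≤-trans 0<1 (≤-by (<⇒≤ (·1-< {zero} {n} ℕ.z≤n)) refl)
  ·1-< (ℕ.s≤s m≤n) = +-monoʳ-< 1# (·1-< m≤n)

  1/suc : ℕ → Carrier
  1/suc n = proj₁ (inverse (·1-< (ℕ.z≤n {n})))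

  1/suc-inverse : ∀ n → 1/suc n * (suc n · 1#) ≈ 1#
  1/suc-inverse n = proj₁ (proj₂ (inverse (·1-< (ℕ.z≤n {n}))))

  1/suc-pos : ∀ n → 0# < 1/suc n
  1/suc-pos n = proj₂ (proj₂ (inverse (·1-< (ℕ.z≤n {n}))))

  -- Here `s` is the slack of a constraint and `δ` its rate of change along a direction. For
  -- positive slack the Archimedean property gives N beyond -δ/s, and s + δ/(n+1) factors as
  -- (s/(n+1)) · ((n+1) - (-δ/s)), a product of positive numbers when n ≥ N. For zero slack the rate
  -- has to vanish.
  eventually-nonneg : ∀ {s δ} → 0# < s ⊎ (0# ≤ s × δ ≈ 0#) →
                      Eventually λ n → 0# ≤ s + 1/suc n * δ
  eventually-nonneg (inj₂ (0≤s , δ≈0)) = 0 , λ n _ →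
    ≤-respʳ (sym (trans (+-congˡ (trans (*-congˡ δ≈0) (zeroʳ _))) (+-identityʳ _))) 0≤s
  eventually-nonneg {s} {δ} (inj₁ 0<s) with inverse 0<s
  ... | s⁻¹ , s⁻¹s≈1 , _ with archimedean (s⁻¹ * (- δ))
  ...   | N , s⁻¹[-δ]<N = N , λ n N≤n → let ε = 1/suc n ; M = suc n · 1# in
    <⇒≤ (<-respʳ-≈
      (begin
        ε * (s * (M - s⁻¹ * (- δ)))          ≈⟨ solve 5 (λ ε s M t δ → ε :* (s :* (M :- t :* (:- δ)))
                                                 := (ε :* M) :* s :+ (t :* s) :* (ε :* δ)) refl ε s M s⁻¹ δ ⟩
        (ε * M) * s + (s⁻¹ * s) * (ε * δ)    ≈⟨ +-cong (*-congʳ (1/suc-inverse n)) (*-congʳ s⁻¹s≈1) ⟩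
        1# * s + 1# * (ε * δ)                ≈⟨ +-cong (*-identityˡ _) (*-identityˡ _) ⟩
        s + ε * δ                            ∎)
      (*-pos (1/suc-pos n) (*-pos 0<s (0<- (<-trans s⁻¹[-δ]<N (·1-< N≤n))))))
    where open SetoidReasoning setoid

-- Cardinality and parity of finite subsets

sumℕ-mono-≤ : ∀ {n} {f g : Fin n → ℕ} → (∀ i → f i ℕ.≤ g i) → sumℕ f ℕ.≤ sumℕ g
sumℕ-mono-≤ {zero}  f≤g = z≤n
sumℕ-mono-≤ {suc n} f≤g = ℕ.+-mono-≤ (f≤g zero) (sumℕ-mono-≤ (f≤g ∘ suc))

sumℕ-mono-< : ∀ {n} {f g : Fin n → ℕ} → (∀ i → f i ℕ.≤ g i) → ∀ i → f i ℕ.< g i → sumℕ f ℕ.< sumℕ g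
sumℕ-mono-< f≤g zero    f₀<g₀ = ℕ.+-mono-<-≤ f₀<g₀ (sumℕ-mono-≤ (f≤g ∘ suc))
sumℕ-mono-< f≤g (suc i) fᵢ<gᵢ = ℕ.+-mono-≤-< (f≤g zero) (sumℕ-mono-< (f≤g ∘ suc) i fᵢ<gᵢ)

private variable
  n : ℕ

∣∣≡sum : (p : Subset n) → ∣ p ∣ ≡ sumℕ (λ x → if lookup p x then 1 else 0)
∣∣≡sum []          = ≡.refl
∣∣≡sum (true  ∷ p) = cong suc (∣∣≡sum p)
∣∣≡sum (false ∷ p) = ∣∣≡sum p

∣∣≡0⇒false : (p : Subset n) → ∣ p ∣ ≡ 0 → ∀ x → lookup p x ≡ false
∣∣≡0⇒false (false ∷ p) eq zero    = ≡.refl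
∣∣≡0⇒false (false ∷ p) eq (suc x) = ∣∣≡0⇒false p eq x

true⇒∣∣≢0 : (p : Subset n) → ∀ x → lookup p x ≡ true → ∣ p ∣ ≢ 0
true⇒∣∣≢0 p x x∈p ∣p∣≡0 with ≡.trans (≡.sym x∈p) (∣∣≡0⇒false p ∣p∣≡0 x)
... | ()

∣∣≢0⇒true : (p : Subset n) → ∣ p ∣ ≢ 0 → ∃[ x ] lookup p x ≡ true
∣∣≢0⇒true []          ≢0 = contradiction ≡.refl ≢0
∣∣≢0⇒true (true  ∷ p) ≢0 = zero , ≡.refl
∣∣≢0⇒true (false ∷ p) ≢0 with ∣∣≢0⇒true p ≢0
... | x , x∈p = suc x , x∈p

singleton : (p : Subset n) → ∣ p ∣ ≡ 1 → ∃[ a ] lookup p a ≡ true × ∀ c → lookup p c ≡ true → c ≡ a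
singleton (true ∷ p) eq = zero , ≡.refl , λ
  { zero    _   → ≡.refl
  ; (suc c) c∈p → contradiction (ℕ.suc-injective eq) (true⇒∣∣≢0 p c c∈p) }
singleton (false ∷ p) eq with singleton p eq
... | a , a∈p , unique = suc a , a∈p , λ { (suc c) c∈p → cong suc (unique c c∈p) }

doubleton : (p : Subset n) → ∣ p ∣ ≡ 2 →
            ∃[ a ] ∃[ b ] a ≢ b × lookup p a ≡ true × lookup p b ≡ true ×
            ∀ c → lookup p c ≡ true → c ≡ a ⊎ c ≡ b
doubleton (true ∷ p) eq with singleton p (ℕ.suc-injective eq)
... | b , b∈p , unique = zero , suc b , (λ ()) , ≡.refl , b∈p , λ
  { zero    _   → inj₁ ≡.refl
  ; (suc c) c∈p → inj₂ (cong suc (unique c c∈p)) }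
doubleton (false ∷ p) eq with doubleton p eq
... | a , b , a≢b , a∈p , b∈p , only =
  suc a , suc b , (λ { ≡.refl → a≢b ≡.refl }) , a∈p , b∈p , λ
  { (suc c) c∈p → Sum.map (cong suc) (cong suc) (only c c∈p) }

_△_ : Subset n → Subset n → Subset n
_△_ = zipWith _xor_

parity-suc : ∀ m → parity (suc m) ≡ parity m ℙ.⁻¹
parity-suc = ℙ.+-homo-+ 1

parity-△ : (p q : Subset n) → parity ∣ p △ q ∣ ≡ parity ∣ p ∣ ℙ.+ parity ∣ q ∣
parity-△ []          []          = ≡.refl
parity-△ (true  ∷ p) (true  ∷ q)
  rewrite parity-suc ∣ p ∣ | parity-suc ∣ q ∣ | parity-△ p q = both (parity ∣ p ∣) (parity ∣ q ∣)
  where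
  both : ∀ a b → a ℙ.+ b ≡ a ℙ.⁻¹ ℙ.+ b ℙ.⁻¹
  both 0ℙ 0ℙ = ≡.refl
  both 0ℙ 1ℙ = ≡.refl
  both 1ℙ 0ℙ = ≡.refl
  both 1ℙ 1ℙ = ≡.refl
parity-△ (true  ∷ p) (false ∷ q)
  rewrite parity-suc ∣ p ∣ | parity-suc ∣ p △ q ∣ | parity-△ p q = left (parity ∣ p ∣) (parity ∣ q ∣)
  where
  left : ∀ a b → (a ℙ.+ b) ℙ.⁻¹ ≡ a ℙ.⁻¹ ℙ.+ b
  left 0ℙ b = ≡.refl
  left 1ℙ 0ℙ = ≡.refl
  left 1ℙ 1ℙ = ≡.refl
parity-△ (false ∷ p) (true  ∷ q)
  rewrite parity-suc ∣ q ∣ | parity-suc ∣ p △ q ∣ | parity-△ p q = right (parity ∣ p ∣) (parity ∣ q ∣)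
  where
  right : ∀ a b → (a ℙ.+ b) ℙ.⁻¹ ≡ a ℙ.+ b ℙ.⁻¹
  right 0ℙ b = ≡.refl
  right 1ℙ 0ℙ = ≡.refl
  right 1ℙ 1ℙ = ≡.refl
parity-△ (false ∷ p) (false ∷ q) = parity-△ p q

xor-false⇒≡ : ∀ a b → a xor b ≡ false → a ≡ b
xor-false⇒≡ true  true  _ = ≡.refl
xor-false⇒≡ false false _ = ≡.refl

-- Parity is additive under symmetric difference, so equal parities rule out a difference of size 1.
-- Applied to two odd sets at one check, it supplies the lower bound 2 that equals the sum of two
-- tight distances.
△-small : (p q : Subset n) → parity ∣ p ∣ ≡ parity ∣ q ∣ →
          (∀ x → lookup p x ≡ lookup q x) ⊎ 2 ℕ.≤ ∣ p △ q ∣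
△-small p q same with ∣ p △ q ∣ in eq
... | 0 = inj₁ λ x → xor-false⇒≡ _ _ (≡.trans (≡.sym (lookup-zipWith _xor_ x p q)) (∣∣≡0⇒false (p △ q) eq x))
... | suc (suc k) = inj₂ (s≤s (s≤s z≤n))
... | 1 with ≡.trans (≡.sym (cong parity eq)) (≡.trans (parity-△ p q) (≡.trans (cong (ℙ._+ parity ∣ q ∣) same) (p+p≡0 (parity ∣ q ∣))))
  where
  p+p≡0 : ∀ p → p ℙ.+ p ≡ 0ℙ
  p+p≡0 0ℙ = ≡.refl
  p+p≡0 1ℙ = ≡.refl
...   | ()

-- Double counting of incidences between checks and a set of variables

module Counting (C : Code) (cc : IsCycleCode C) (F : Subset (Code.∣X∣ C)) where
  open Code C

  lookup-row : ∀ u x → lookup (row u) x ≡ H u x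
  lookup-row u x = lookup∘tabulate _ x

  lookup-row∩ : ∀ u x → lookup (row u ∩ F) x ≡ H u x ∧ lookup F x
  lookup-row∩ u x = ≡.trans (lookup-zipWith _∧_ x (row u) F) (cong (_∧ lookup F x) (lookup-row u x))

  -- Exchanging the sums counts each variable of `F` once for each entry 1 in its column, and a
  -- column of a cycle code has two.
  handshake : sumℕ (λ u → ∣ row u ∩ F ∣) ≡ 2 ℕ.* ∣ F ∣
  handshake = begin
    sumℕ (λ u → ∣ row u ∩ F ∣)                              ≡⟨ sumℕ-cong (λ u → ≡.trans (∣∣≡sum (row u ∩ F))
                                                              (sumℕ-cong (λ x → cong (if_then 1 else 0) (lookup-row∩ u x)))) ⟩
    sumℕ (λ u → sumℕ (λ x → if H u x ∧ lookup F x then 1 else 0))  ≡⟨ sumℕ-comm (λ u x → if H u x ∧ lookup F x then 1 else 0) ⟩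
    sumℕ (λ x → sumℕ (λ u → if H u x ∧ lookup F x then 1 else 0))  ≡⟨ sumℕ-cong degree ⟩
    sumℕ (λ x → 2 ℕ.* (if lookup F x then 1 else 0))        ≡⟨ *-distribˡ-sumℕ 2 (λ x → if lookup F x then 1 else 0) ⟨
    2 ℕ.* sumℕ (λ x → if lookup F x then 1 else 0)          ≡⟨ cong (2 ℕ.*_) (∣∣≡sum F) ⟨
    2 ℕ.* ∣ F ∣                                             ∎
    where
    open ≡-Reasoning
    degree : ∀ x → sumℕ (λ u → if H u x ∧ lookup F x then 1 else 0) ≡ 2 ℕ.* (if lookup F x then 1 else 0)
    degree x with lookup F x
    ... | true  = ≡.trans (sumℕ-cong (λ u → cong (if_then 1 else 0)
                    (≡.trans (∧-true (H u x)) (≡.sym (lookup∘tabulate _ u)))))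
                    (≡.trans (≡.sym (∣∣≡sum (column x))) (cc x))
      where
      ∧-true : ∀ b → b ∧ true ≡ b
      ∧-true true  = ≡.refl
      ∧-true false = ≡.refl
    ... | false = ≡.trans (sumℕ-cong (λ u → cong (if_then 1 else 0) (∧-false (H u x)))) (sumℕ-zero ∣U∣)
      where
      ∧-false : ∀ b → b ∧ false ≡ false
      ∧-false true  = ≡.refl
      ∧-false false = ≡.refl

  positive : ℕ → Bool
  positive zero    = false
  positive (suc _) = true

  touched : Subset ∣U∣
  touched = tabulate (λ u → positive ∣ row u ∩ F ∣)

  -- A touched check contributes at least 2 to the handshake sum, and `u₀` contributes more. The
  -- strict inequality is what makes the system with one equation per touched check underdetermined.
  touched<F : (∀ u → ∣ row u ∩ F ∣ ≢ 1) → ∀ u₀ → 2 ℕ.< ∣ row u₀ ∩ F ∣ → ∣ touched ∣ ℕ.< ∣ F ∣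
  touched<F ≢1 u₀ 2<Fu₀ = ℕ.*-cancelˡ-< 2 _ _ (begin-strict
    2 ℕ.* ∣ touched ∣                                          ≡⟨ cong (2 ℕ.*_) (∣∣≡sum touched) ⟩
    2 ℕ.* sumℕ (λ u → if lookup touched u then 1 else 0)       ≡⟨ *-distribˡ-sumℕ 2 (λ u → if lookup touched u then 1 else 0) ⟩
    sumℕ (λ u → 2 ℕ.* (if lookup touched u then 1 else 0))     ≡⟨ sumℕ-cong (λ u → cong (λ b → 2 ℕ.* (if b then 1 else 0)) (lookup∘tabulate (λ u → positive ∣ row u ∩ F ∣) u)) ⟩
    sumℕ (λ u → 2 ℕ.* (if positive ∣ row u ∩ F ∣ then 1 else 0))  <⟨ sumℕ-mono-< (λ u → at-least (≢1 u)) u₀ (more 2<Fu₀) ⟩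
    sumℕ (λ u → ∣ row u ∩ F ∣)                                 ≡⟨ handshake ⟩
    2 ℕ.* ∣ F ∣                                                ∎)
    where
    open ℕ.≤-Reasoning
    at-least : ∀ {k} → k ≢ 1 → 2 ℕ.* (if positive k then 1 else 0) ℕ.≤ k
    at-least {0} _ = z≤n
    at-least {1} ≢1 = contradiction ≡.refl ≢1
    at-least {suc (suc k)} _ = s≤s (s≤s z≤n)
    more : ∀ {k} → 2 ℕ.< k → 2 ℕ.* (if positive k then 1 else 0) ℕ.< k
    more {suc k} 2<k = 2<k

-- Underdetermined linear systems

∣∣-remove : ∀ {n} (E : Subset n) j → lookup E j ≡ true → ∣ E ∣ ≡ suc ∣ E [ j ]≔ false ∣
∣∣-remove (true  ∷ E) zero    _   = ≡.refl
∣∣-remove (true  ∷ E) (suc j) j∈E = cong suc (∣∣-remove E j j∈E)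
∣∣-remove (false ∷ E) (suc j) j∈E = ∣∣-remove E j j∈E

module LinearAlgebra {c ℓ₁ ℓ₂} (ℝ : RealNumbers c ℓ₁ ℓ₂) where
  open Reals ℝ
  open HeytingProperties heytingCommutativeRing using (#-congʳ)
  open SetoidReasoning setoid

  sum-cong : ∀ {n} {f g : Fin n → Carrier} → (∀ x → f x ≈ g x) → sum f ≈ sum g
  sum-cong {n} {f} {g} = sum-cong-≋ {n} {f} {g}

  sum-zero : ∀ {n} {f : Fin n → Carrier} → (∀ x → f x ≈ 0#) → sum f ≈ 0#
  sum-zero {n} f≈0 = trans (sum-cong f≈0) (sum-replicate-zero n)

  sum-linear : ∀ {n} α β (f g : Fin n → Carrier) →
               sum (λ x → α * f x + β * g x) ≈ α * sum f + β * sum g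
  sum-linear α β f g = begin
    sum (λ x → α * f x + β * g x)                ≈⟨ ∑-distrib-+ (λ x → α * f x) (λ x → β * g x) ⟩
    sum (λ x → α * f x) + sum (λ x → β * g x)    ≈⟨ +-cong (*-distribˡ-sum α f) (*-distribˡ-sum β g) ⟨
    α * sum f + β * sum g                        ∎

  δ : ∀ {n} → Fin n → Fin n → Carrier
  δ j x = if does (x ≟ j) then 1# else 0#

  sum-δ : ∀ {n} (f : Fin n → Carrier) j → sum (λ x → f x * δ j x) ≈ f j
  sum-δ f zero    = trans (+-cong (*-identityʳ _) (sum-zero (λ x → zeroʳ (f (suc x))))) (+-identityʳ _)
  sum-δ f (suc j) = trans (+-cong (zeroʳ _) (sum-δ (f ∘ suc) j)) (+-identityˡ _)

  δ-≢ : ∀ {n} {j x : Fin n} → x ≢ j → δ j x ≈ 0#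
  δ-≢ {j = j} {x} x≢j with x ≟ j
  ... | yes x≡j = contradiction x≡j x≢j
  ... | no  _   = refl

  δ-≡ : ∀ {n} (j : Fin n) → δ j j ≈ 1#
  δ-≡ j with j ≟ j
  ... | yes _   = refl
  ... | no  j≢j = contradiction ≡.refl j≢j

  dot : ∀ {n} → (Fin n → Carrier) → (Fin n → Carrier) → Carrier
  dot a d = sum (λ x → a x * d x)

  -- Gaussian elimination; whether the first equation has a pivot can only be
  -- decided under a double negation.
  underdetermined : ∀ {m n} (A : Fin m → Fin n → Carrier) (V : Subset m) (E : Subset n) →
    ∣ V ∣ ℕ.< ∣ E ∣ →
    ¬ ¬ (∃[ d ] (∀ x → lookup E x ≡ false → d x ≈ 0#) × (∃[ x ] d x # 0#) ×
                (∀ u → lookup V u ≡ true → dot (A u) d ≈ 0#))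
  underdetermined A [] E 0<∣E∣ none with ∣∣≢0⇒true E (ℕ.>⇒≢ 0<∣E∣)
  ... | e , e∈E = none (δ e , (λ x x∉E → δ-≢ {j = e} {x} λ { ≡.refl → contradiction (≡.trans (≡.sym e∈E) x∉E) λ () }) ,
                        (e , #-congʳ (sym (δ-≡ e)) 1#0) , λ ())
  underdetermined A (false ∷ V) E V<E none =
    underdetermined (A ∘ suc) V E V<E λ (d , supp , d#0 , sol) →
    none (d , supp , d#0 , λ { (suc u) u∈V → sol u u∈V })
  underdetermined {n = n} A (true ∷ V) E V<E none = ¬¬-excluded-middle {A = ∃[ j ] lookup E j ≡ true × A zero j # 0#} λ
    -- Without a pivot, tightness makes all coefficients on `E` zero, so the first equation holds
    -- for every direction supported on `E`.
    { (no ¬pivot) → underdetermined (A ∘ suc) V E (ℕ.<-trans (ℕ.n<1+n _) V<E) λ (d , supp , d#0 , sol) →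
        none (d , supp , d#0 , λ
          { zero    _   → sum-zero (λ x → vanish ¬pivot d supp x)
          ; (suc u) u∈V → sol u u∈V })
    ; (yes (j , j∈E , aj#0)) → eliminate j j∈E aj#0 }
    where
    a : Fin n → Carrier
    a = A zero

    vanish : ¬ (∃[ j ] lookup E j ≡ true × a j # 0#) → ∀ d → (∀ x → lookup E x ≡ false → d x ≈ 0#) →
             ∀ x → a x * d x ≈ 0#
    vanish ¬pivot d supp x with lookup E x in eq
    ... | false = trans (*-congˡ (supp x eq)) (zeroʳ _)
    ... | true  = trans (*-congʳ (proj₁ (tight _ _) λ ax#0 → ¬pivot (x , eq , ax#0))) (zeroˡ _)

    eliminate : ∀ j → lookup E j ≡ true → a j # 0# → _
    eliminate j j∈E aj#0 = underdetermined B V E′ V<E′ λ (d , supp , (k , dk#0) , sol) →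
      none ( lift d
           , (λ x x∉E → begin
               a j * d x - dot a d * δ j x   ≈⟨ +-cong (*-congˡ (supp x (E⊇E′ x x∉E)))
                                                 (-‿cong (*-congˡ (δ-≢ (x≢j x x∉E)))) ⟩
               a j * 0# - dot a d * 0#       ≈⟨ solve 2 (λ a s → a :* con (+ 0) :- s :* con (+ 0) := con (+ 0)) refl (a j) (dot a d) ⟩
               0#                            ∎)
           , (k , #-congʳ (sym (lift-≢ d (λ { ≡.refl → proj₂ (tight _ _) (supp j (lookup∘update j E false)) dk#0 })))
                    (x#0y#0→xy#0 aj#0 dk#0))
           , λ { zero _ → trans (dot-lift a d) (-‿inverseʳ′ (a j) (dot a d))
               ; (suc u) u∈V → trans (dot-lift (A (suc u)) d) (trans (sym (dot-B u d)) (sol u u∈V)) } )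
      where
      E′ : Subset n
      E′ = E [ j ]≔ false

      -- Fraction-free elimination: scaling by the pivot instead of dividing by it, while column `j`
      -- cancels.
      B : Fin _ → Fin n → Carrier
      B u x = a j * A (suc u) x - A (suc u) j * a x

      -- The solution `d` vanishes at `j`, which is outside `E′`. Coordinate `j` is reset so that
      -- the pivot equation holds, and the others are scaled by the pivot, which keeps a coordinate
      -- apart from 0.
      lift : (Fin n → Carrier) → Fin n → Carrier
      lift d x = a j * d x - dot a d * δ j x

      V<E′ : ∣ V ∣ ℕ.< ∣ E′ ∣
      V<E′ = ℕ.s<s⁻¹ (≡.subst (suc ∣ V ∣ ℕ.<_) (∣∣-remove E j j∈E) V<E)

      x≢j : ∀ x → lookup E x ≡ false → x ≢ j
      x≢j x x∉E ≡.refl = contradiction (≡.trans (≡.sym j∈E) x∉E) λ ()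

      E⊇E′ : ∀ x → lookup E x ≡ false → lookup E′ x ≡ false
      E⊇E′ x x∉E = ≡.trans (lookup∘update′ (x≢j x x∉E) E false) x∉E

      lift-≢ : ∀ d {x} → x ≢ j → lift d x ≈ a j * d x
      lift-≢ d {x} x≢j = begin
        a j * d x - dot a d * δ j x   ≈⟨ +-congˡ (-‿cong (*-congˡ (δ-≢ x≢j))) ⟩
        a j * d x - dot a d * 0#      ≈⟨ solve 2 (λ p s → p :- s :* con (+ 0) := p) refl (a j * d x) (dot a d) ⟩
        a j * d x                     ∎

      -‿inverseʳ′ : ∀ x s → x * s + (- s) * x ≈ 0#
      -‿inverseʳ′ = solve 2 (λ x s → x :* s :+ (:- s) :* x := con (+ 0)) refl

      dot-lift : ∀ r d → dot r (lift d) ≈ a j * dot r d + (- dot a d) * r j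
      dot-lift r d = begin
        sum (λ x → r x * (a j * d x - dot a d * δ j x))                   ≈⟨ sum-cong (λ x →
          solve 5 (λ r a d s t → r :* (a :* d :- s :* t) := a :* (r :* d) :+ (:- s) :* (r :* t))
            refl (r x) (a j) (d x) (dot a d) (δ j x)) ⟩
        sum (λ x → a j * (r x * d x) + (- dot a d) * (r x * δ j x))       ≈⟨ sum-linear (a j) (- dot a d) (λ x → r x * d x) (λ x → r x * δ j x) ⟩
        a j * dot r d + (- dot a d) * sum (λ x → r x * δ j x)             ≈⟨ +-congˡ (*-congˡ (sum-δ r j)) ⟩
        a j * dot r d + (- dot a d) * r j                                 ∎

      dot-B : ∀ u d → dot (B u) d ≈ a j * dot (A (suc u)) d + (- dot a d) * A (suc u) j
      dot-B u d = begin
        sum (λ x → (a j * A (suc u) x - A (suc u) j * a x) * d x)         ≈⟨ sum-cong (λ x →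
          solve 5 (λ a r p b d → (a :* r :- p :* b) :* d := a :* (r :* d) :+ (:- p) :* (b :* d))
            refl (a j) (A (suc u) x) (A (suc u) j) (a x) (d x)) ⟩
        sum (λ x → a j * (A (suc u) x * d x) + (- A (suc u) j) * (a x * d x))  ≈⟨ sum-linear (a j) (- A (suc u) j) (λ x → A (suc u) x * d x) (λ x → a x * d x) ⟩
        a j * dot (A (suc u)) d + (- A (suc u) j) * dot a d               ≈⟨ +-congˡ (solve 2 (λ p s → (:- p) :* s := (:- s) :* p) refl (A (suc u) j) (dot a d)) ⟩
        a j * dot (A (suc u)) d + (- dot a d) * A (suc u) j               ∎

-- The fundamental polytope and its extreme points

lookup-─ : ∀ {n} (p q : Subset n) x → lookup (p ─ q) x ≡ lookup p x ∧ not (lookup q x)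
lookup-─ (true  ∷ p) (true  ∷ q) zero = ≡.refl
lookup-─ (true  ∷ p) (false ∷ q) zero = ≡.refl
lookup-─ (false ∷ p) (true  ∷ q) zero = ≡.refl
lookup-─ (false ∷ p) (false ∷ q) zero = ≡.refl
lookup-─ (_ ∷ p) (_ ∷ q) (suc x) = lookup-─ p q x

lookup-injective : ∀ {n} {p q : Subset n} → (∀ x → lookup p x ≡ lookup q x) → p ≡ q
lookup-injective {p = p} {q} eq =
  ≡.trans (≡.sym (tabulate∘lookup p)) (≡.trans (tabulate-cong eq) (tabulate∘lookup q))

module Polytope {c ℓ₁ ℓ₂} (ℝ : RealNumbers c ℓ₁ ℓ₂) (C : Code) where
  open Reals ℝ
  open LinearAlgebra ℝ
  open Code C
  open SetoidReasoning setoid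

  sum-indicator : ∀ {n} (p : Subset n) → sum (λ x → if lookup p x then 1# else 0#) ≈ ∣ p ∣ · 1#
  sum-indicator []          = refl
  sum-indicator (true  ∷ p) = +-congˡ (sum-indicator p)
  sum-indicator (false ∷ p) = trans (+-identityˡ _) (sum-indicator p)

  Within-row : U → Subset ∣X∣ → Set
  Within-row u S = ∀ x → lookup S x ≡ true → H u x ≡ true

  Odd : Subset ∣X∣ → Set
  Odd S = parity ∣ S ∣ ≡ 1ℙ

  -- For `a` in the unit interval this is the absolute difference between `a` and the bit `b`.
  flip : Bool → Carrier → Carrier
  flip b a = if b then 1# - a else a

  gap : U → Subset ∣X∣ → Point ℝ ∣X∣ → X → Carrier
  gap u S f x = if H u x then flip (lookup S x) (f x) else 0#

  -- For f in the unit cube this is the ℓ₁-distance on N(u) from f to the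
  -- indicator of S, and the parity-check inequality of S at u says that it is
  -- at least 1.
  distance : U → Subset ∣X∣ → Point ℝ ∣X∣ → Carrier
  distance u S f = sum (gap u S f)

  checkSum : U → Subset ∣X∣ → Point ℝ ∣X∣ → Carrier
  checkSum u S f = sumOver ℝ S f + sumOver ℝ (row u ─ S) (λ x → 1# - f x)

  -- At each neighbour of `u` one of the two sums takes `f x` and the other takes `1# - f x`, so the
  -- neighbour contributes exactly 1. A bound on either sum is thus a bound on the other.
  checkSum+distance : ∀ u S f → Within-row u S → checkSum u S f + distance u S f ≈ ∣ row u ∣ · 1#
  checkSum+distance u S f S⊆u = begin
    checkSum u S f + distance u S f   ≈⟨ +-congʳ (∑-distrib-+ a b) ⟨
    sum (λ x → a x + b x) + sum (gap u S f)  ≈⟨ ∑-distrib-+ (λ x → a x + b x) (gap u S f) ⟨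
    sum (λ x → a x + b x + gap u S f x)      ≈⟨ sum-cong pointwise ⟩
    sum (λ x → if lookup (row u) x then 1# else 0#)  ≈⟨ sum-indicator (row u) ⟩
    ∣ row u ∣ · 1#                            ∎
    where
    a b : X → Carrier
    a x = if lookup S x then f x else 0#
    b x = if lookup (row u ─ S) x then 1# - f x else 0#

    pointwise : ∀ x → a x + b x + gap u S f x ≈ (if lookup (row u) x then 1# else 0#)
    pointwise x rewrite lookup-─ (row u) S x | lookup∘tabulate (H u) x
      with H u x in hx | lookup S x in sx
    ... | true  | true  = solve 1 (λ f → f :+ con (+ 0) :+ (con (+ 1) :- f) := con (+ 1)) refl (f x)
    ... | true  | false = solve 1 (λ f → con (+ 0) :+ (con (+ 1) :- f) :+ f := con (+ 1)) refl (f x)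
    ... | false | false = trans (+-identityʳ _) (+-identityʳ _)
    ... | false | true  = contradiction (≡.trans (≡.sym (S⊆u x sx)) hx) λ ()

  check⇒distance : ∀ u S f → Within-row u S → checkSum u S f ≤ ∣ row u ∣ · 1# - 1# → 1# ≤ distance u S f
  check⇒distance u S f S⊆u chk = ≤-by (0≤- chk) (begin
    1# + (∣ row u ∣ · 1# - 1# - L)   ≈⟨ +-congˡ (+-congʳ (+-congʳ (checkSum+distance u S f S⊆u))) ⟨
    1# + (L + g - 1# - L)            ≈⟨ solve 2 (λ L g → con (+ 1) :+ (L :+ g :- con (+ 1) :- L) := g) refl L g ⟩
    g                                ∎)
    where
    L = checkSum u S f
    g = distance u S f

  distance⇒check : ∀ u S f → Within-row u S → 1# ≤ distance u S f → checkSum u S f ≤ ∣ row u ∣ · 1# - 1#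
  distance⇒check u S f S⊆u 1≤g = ≤-by (0≤- 1≤g) (begin
    L + (g - 1#)               ≈⟨ solve 2 (λ L g → L :+ (g :- con (+ 1)) := L :+ g :- con (+ 1)) refl L g ⟩
    L + g - 1#                 ≈⟨ +-congʳ (checkSum+distance u S f S⊆u) ⟩
    ∣ row u ∣ · 1# - 1#        ∎)
    where
    L = checkSum u S f
    g = distance u S f

  -- The gradient of `distance u S`, which is an affine function of the point.
  normal : U → Subset ∣X∣ → X → Carrier
  normal u S x = if H u x then (if lookup S x then - 1# else 1#) else 0#

  distance-step : ∀ u S f d ε →
    distance u S (λ x → f x + ε * d x) ≈ distance u S f + ε * dot (normal u S) d
  distance-step u S f d ε = begin
    distance u S (λ x → f x + ε * d x)                         ≈⟨ sum-cong pointwise ⟩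
    sum (λ x → 1# * gap u S f x + ε * (normal u S x * d x))    ≈⟨ sum-linear 1# ε (gap u S f) (λ x → normal u S x * d x) ⟩
    1# * distance u S f + ε * dot (normal u S) d               ≈⟨ +-congʳ (*-identityˡ _) ⟩
    distance u S f + ε * dot (normal u S) d                    ∎
    where
    pointwise : ∀ x → gap u S (λ x → f x + ε * d x) x ≈ 1# * gap u S f x + ε * (normal u S x * d x)
    pointwise x with H u x | lookup S x
    ... | true  | true  = solve 3 (λ f e d → con (+ 1) :- (f :+ e :* d) := con (+ 1) :* (con (+ 1) :- f) :+ e :* (:- con (+ 1) :* d)) refl (f x) ε (d x)
    ... | true  | false = solve 3 (λ f e d → f :+ e :* d := con (+ 1) :* f :+ e :* (con (+ 1) :* d)) refl (f x) ε (d x)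
    ... | false | _     = solve 2 (λ e d → con (+ 0) := con (+ 1) :* con (+ 0) :+ e :* (con (+ 0) :* d)) refl ε (d x)

  data Kind (a : Carrier) : Set (c ⊔ ℓ₁ ⊔ ℓ₂) where
    zero       : a ≈ 0# → Kind a
    one        : a ≈ 1# → Kind a
    fractional : 0# < a → a < 1# → Kind a

  isFractional : ∀ {a} → Kind a → Bool
  isFractional (zero _)         = false
  isFractional (one _)          = false
  isFractional (fractional _ _) = true

  flip-nonneg : ∀ b {a} → 0# ≤ a → a ≤ 1# → 0# ≤ flip b a
  flip-nonneg true  _   a≤1 = 0≤- a≤1
  flip-nonneg false 0≤a _   = 0≤a

  flip-pos : ∀ b {a} → 0# < a → a < 1# → 0# < flip b a
  flip-pos true  _   a<1 = 0<- a<1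
  flip-pos false 0<a _   = 0<a

  flip-<1 : ∀ b {a} → 0# < a → a < 1# → flip b a < 1#
  flip-<1 true  {a} 0<a _   = <-by 0<a (solve 1 (λ a → con (+ 1) :- a :+ a := con (+ 1)) refl a)
  flip-<1 false     _   a<1 = a<1

  flip-0 : ∀ {a} → a ≈ 1# → flip true a ≈ 0#
  flip-0 a≈1 = trans (+-congˡ (-‿cong a≈1)) (-‿inverseʳ 1#)

  flip-1 : ∀ {a} → a ≈ 0# → flip true a ≈ 1#
  flip-1 a≈0 = trans (+-congˡ (-‿cong a≈0)) (x-0≈x 1#)

  flip-integral : ∀ b {a} → a ≈ 0# ⊎ a ≈ 1# → flip b a ≈ 0# ⊎ flip b a ≈ 1#
  flip-integral true  (inj₁ a≈0) = inj₂ (flip-1 a≈0)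
  flip-integral true  (inj₂ a≈1) = inj₁ (flip-0 a≈1)
  flip-integral false 0∨1        = 0∨1

  flip+flip : ∀ b b′ a → b xor b′ ≡ true → flip b a + flip b′ a ≈ 1#
  flip+flip true  false a _ = solve 1 (λ a → con (+ 1) :- a :+ a := con (+ 1)) refl a
  flip+flip false true  a _ = solve 1 (λ a → a :+ (con (+ 1) :- a) := con (+ 1)) refl a

-- Extreme points with classified coordinates

module Extreme {c ℓ₁ ℓ₂} (ℝ : RealNumbers c ℓ₁ ℓ₂) (C : Code) (cc : IsCycleCode C)
  (ω : Point ℝ (Code.∣X∣ C)) (ext : IsLPPseudocodeword ℝ C ω)
  (kind : ∀ x → Polytope.Kind ℝ C (ω x)) where

  open Reals ℝ
  open LinearAlgebra ℝ
  open Polytope ℝ C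
  open Code C
  open SetoidReasoning setoid

  P : Point ℝ ∣X∣ → Set ℓ₂
  P = FundamentalPolytope ℝ C

  open FundamentalPolytope (proj₁ ext)

  F : Subset ∣X∣
  F = tabulate (λ x → isFractional (kind x))

  open Counting C cc F

  F-fractional : ∀ x → lookup F x ≡ true → 0# < ω x × ω x < 1#
  F-fractional x x∈F rewrite lookup∘tabulate (λ x → isFractional (kind x)) x with kind x
  ... | fractional 0<ω ω<1 = 0<ω , ω<1

  F-integral : ∀ x → lookup F x ≡ false → ω x ≈ 0# ⊎ ω x ≈ 1#
  F-integral x x∉F rewrite lookup∘tabulate (λ x → isFractional (kind x)) x with kind x
  ... | zero ω≈0 = inj₁ ω≈0
  ... | one  ω≈1 = inj₂ ω≈1

  row∩F : ∀ {u x} → H u x ≡ true → lookup F x ≡ true → lookup (row u ∩ F) x ≡ true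
  row∩F {u} {x} hx fx = ≡.trans (lookup-row∩ u x) (cong₂ _∧_ hx fx)

  row∩F⁻ : ∀ {u x} → lookup (row u ∩ F) x ≡ true → H u x ≡ true × lookup F x ≡ true
  row∩F⁻ {u} {x} x∈ with ≡.trans (≡.sym (lookup-row∩ u x)) x∈
  ... | eq with H u x | lookup F x
  ...   | true | true = ≡.refl , ≡.refl

  gap-nonneg : ∀ u S x → 0# ≤ gap u S ω x
  gap-nonneg u S x with H u x
  ... | true  = flip-nonneg (lookup S x) (lower x) (upper x)
  ... | false = ≤-reflexive refl

  gap-pos : ∀ u S x → H u x ≡ true → lookup F x ≡ true → 0# < gap u S ω x
  gap-pos u S x hx x∈F rewrite hx = let (0<ω , ω<1) = F-fractional x x∈F in flip-pos (lookup S x) 0<ω ω<1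

  Tight : U → Subset ∣X∣ → Set ℓ₁
  Tight u S = Within-row u S × Odd S × distance u S ω ≈ 1#

  1≤distance : ∀ u S → Within-row u S → Odd S → 1# ≤ distance u S ω
  1≤distance u S S⊆u odd = check⇒distance u S ω S⊆u
    (check u S (λ x∈S → lookup⇒[]= _ (row u) (≡.trans (lookup-row u _) (S⊆u _ ([]=⇒lookup x∈S)))) odd)

  Supported : Point ℝ ∣X∣ → Set ℓ₁
  Supported d = ∀ x → lookup F x ≡ false → d x ≈ 0#

  -- These are the directions of the smallest face containing `ω`: constraints tight at `ω` stay
  -- constant along them. Support on `F` accounts for the bounds 0 and 1, the second condition for
  -- the parity checks.
  Feasible : Point ℝ ∣X∣ → Set ℓ₁
  Feasible d = Supported d × (∀ u S → Tight u S → dot (normal u S) d ≈ 0#)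

  module _ (d : Point ℝ ∣X∣) (feasible : Feasible d) where

    moved : ℕ → Point ℝ ∣X∣
    moved n x = ω x + 1/suc n * d x

    eventually-bounded : ∀ x → Eventually λ n → 0# ≤ moved n x × moved n x ≤ 1#
    eventually-bounded x = eventually-map (λ n (p , q) → p , ≤-by q (cancel (ω x) (1/suc n) (d x)))
      (eventually-× (eventually-nonneg low) (eventually-nonneg {1# - ω x} { - d x} high))
      where
      cancel : ∀ w e d → w + e * d + (1# - w + e * (- d)) ≈ 1#
      cancel = solve 3 (λ w e d → w :+ e :* d :+ (con (+ 1) :- w :+ e :* (:- d)) := con (+ 1)) refl

      low : 0# < ω x ⊎ (0# ≤ ω x × d x ≈ 0#)
      low with lookup F x in eq
      ... | true  = inj₁ (proj₁ (F-fractional x eq))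
      ... | false = inj₂ (lower x , proj₁ feasible x eq)

      high : 0# < 1# - ω x ⊎ (0# ≤ 1# - ω x × - d x ≈ 0#)
      high with lookup F x in eq
      ... | true  = inj₁ (0<- (proj₂ (F-fractional x eq)))
      ... | false = inj₂ (0≤- (upper x) , trans (-‿cong (proj₁ feasible x eq)) -0#≈0#)

    -- An inequality with slack survives small steps, and a tight one is constant along a feasible
    -- direction. Which case occurs is known only under a double negation.
    ¬¬eventually-check : ∀ u S → ¬ ¬ Eventually λ n → Within-row u S → Odd S → 1# ≤ distance u S (moved n)
    ¬¬eventually-check u S none = ¬¬-excluded-middle {A = Within-row u S × Odd S} λ
      { (no ¬odd) → none (0 , λ _ _ S⊆u odd → contradiction (S⊆u , odd) ¬odd)
      ; (yes (S⊆u , odd)) → ¬¬-excluded-middle {A = 1# < distance u S ω} λ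
          { (yes 1<g) → none (satisfied (inj₁ (0<- 1<g)))
          ; (no  1≮g) → let 1≤g = 1≤distance u S S⊆u odd in
              none (satisfied (inj₂ (0≤- 1≤g , proj₂ feasible u S (S⊆u , odd , ≤-antisym 1≮g 1≤g)))) } }
      where
      g δg : Carrier
      g  = distance u S ω
      δg = dot (normal u S) d

      rearrange : ∀ g e t → 1# + (g - 1# + e * t) ≈ g + e * t
      rearrange = solve 3 (λ g e t → con (+ 1) :+ (g :- con (+ 1) :+ e :* t) := g :+ e :* t) refl

      satisfied : 0# < g - 1# ⊎ (0# ≤ g - 1# × δg ≈ 0#) →
                  Eventually λ n → Within-row u S → Odd S → 1# ≤ distance u S (moved n)
      satisfied slack = eventually-map
        (λ n 0≤ _ _ → ≤-by 0≤ (trans (rearrange g (1/suc n) δg) (sym (distance-step u S ω d (1/suc n)))))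
        (eventually-nonneg {g - 1#} {δg} slack)

    ¬¬eventually-inside : ¬ ¬ Eventually λ n → P (moved n)
    ¬¬eventually-inside none = ¬¬-Fin (λ u → ¬¬-Subset (¬¬eventually-check u)) λ checks →
      none (eventually-map
        (λ n (bounded , odd) → record
          { lower = λ x → proj₁ (bounded x)
          ; upper = λ x → proj₂ (bounded x)
          ; check = λ u S S⊆u odd-S →
              let S⊆ = λ x x∈S → ≡.trans (≡.sym (lookup-row u x)) ([]=⇒lookup (S⊆u (lookup⇒[]= x S x∈S))) in
              distance⇒check u S (moved n) S⊆ (odd u S S⊆ odd-S) })
        (eventually-× (eventually-Fin eventually-bounded)
                      (eventually-Fin (λ u → eventually-Subset (checks u)))))

  normal-neg : ∀ u S d → dot (normal u S) (λ x → - d x) ≈ - dot (normal u S) d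
  normal-neg u S d = begin
    sum (λ x → a x * - d x)                        ≈⟨ sum-cong (λ x → solve 2 (λ a d → a :* (:- d) := (:- con (+ 1)) :* (a :* d) :+ con (+ 0) :* con (+ 0)) refl (a x) (d x)) ⟩
    sum (λ x → - 1# * (a x * d x) + 0# * 0#)       ≈⟨ sum-linear (- 1#) 0# (λ x → a x * d x) (λ _ → 0#) ⟩
    - 1# * dot a d + 0# * sum {∣X∣} (λ _ → 0#)      ≈⟨ solve 2 (λ s z → (:- con (+ 1)) :* s :+ con (+ 0) :* z := :- s) refl (dot a d) (sum {∣X∣} (λ _ → 0#)) ⟩
    - dot a d                                      ∎
    where a = normal u S

  feasible-neg : ∀ {d} → Feasible d → Feasible (λ x → - d x)
  feasible-neg {d} (supp , flat) =
      (λ x x∉F → trans (-‿cong (supp x x∉F)) -0#≈0#)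
    , (λ u S tight-S → trans (normal-neg u S d) (trans (-‿cong (flat u S tight-S)) -0#≈0#))

  -- For small ε both ω + εd and ω - εd lie in the polytope, with midpoint `ω`, so extremality
  -- identifies them and 2εd vanishes.
  rigid : ∀ d → Feasible d → ∀ x → d x ≈ 0#
  rigid d feasible x = ≈-stable λ d≉0 →
    ¬¬eventually-inside d feasible λ ev⁺ →
    ¬¬eventually-inside (λ x → - d x) (feasible-neg feasible) λ ev⁻ →
    let (N , both) = eventually-× ev⁺ ev⁻
        (y∈P , z∈P) = both N ℕ.≤-refl
    in d≉0 (conclude (1/suc N) (1/suc-pos N)
         (proj₂ ext _ _ ½ y∈P z∈P 0<½ ½<1 (λ x → midpoint (ω x) (1/suc N) (d x) ½ 2½≈1) x))
    where
    midpoint : ∀ w e d h → h + h ≈ 1# → w ≈ h * (w + e * d) + (1# - h) * (w + e * - d)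
    midpoint w e d h h+h≈1 = begin
      -- A zero term with factor `1# - 1#` is added so that `h + h` can replace one of the units;
      -- after that the identity holds for every `h`.
      w                                                    ≈⟨ solve 4 (λ w e d h → w := w :+ e :* d :* (con (+ 1) :- con (+ 1))) refl w e d h ⟩
      w + e * d * (1# - 1#)                                ≈⟨ +-congˡ (*-congˡ (+-congʳ h+h≈1)) ⟨
      w + e * d * (h + h - 1#)                             ≈⟨ solve 4 (λ w e d h → w :+ e :* d :* (h :+ h :- con (+ 1))
                                                                := h :* (w :+ e :* d) :+ (con (+ 1) :- h) :* (w :+ e :* (:- d))) refl w e d h ⟩
      h * (w + e * d) + (1# - h) * (w + e * - d)           ∎

    conclude : ∀ e → 0# < e → ω x + e * d x ≈ ω x + e * - d x → d x ≈ 0#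
    conclude e 0<e y≈z = *-cancelˡ-0 (#-sym (<⇒# (<-trans 0<e (<-by 0<e refl)))) (begin
      (e + e) * d x                                ≈⟨ solve 3 (λ w e d → (e :+ e) :* d := w :+ e :* d :- (w :+ e :* (:- d))) refl (ω x) e (d x) ⟩
      ω x + e * d x - (ω x + e * - d x)            ≈⟨ +-congʳ y≈z ⟩
      ω x + e * - d x - (ω x + e * - d x)          ≈⟨ -‿inverseʳ _ ⟩
      0#                                           ∎)

  ·1-mono : ∀ {m n} → m ℕ.≤ n → m · 1# ≤ n · 1#
  ·1-mono {n = zero}  z≤n       = ≤-reflexive refl
  ·1-mono {n = suc n} z≤n       = <⇒≤ (·1-< {0} {n} z≤n)
  ·1-mono             (s≤s m≤n) = +-monoʳ-≤ 1# (·1-mono m≤n)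

  -- Adding two tight inequalities gives 2 = |S △ S′| + 2 · (distances outside
  -- S △ S′), so no room is left for a fractional coordinate outside S △ S′.
  tight-disagree : ∀ u S S′ → Tight u S → Tight u S′ →
    (∀ x → lookup S x ≡ lookup S′ x) ⊎
    (∀ x → H u x ≡ true → lookup F x ≡ true → lookup S x xor lookup S′ x ≡ true)
  tight-disagree u S S′ (S⊆u , odd , g≈1) (S′⊆u , odd′ , g′≈1)
    with △-small S S′ (≡.trans odd (≡.sym odd′))
  ... | inj₁ S≡S′ = inj₁ S≡S′
  ... | inj₂ 2≤△  = inj₂ disagree
    where
    k : X → Carrier
    k x = if lookup (S △ S′) x then 1# else 0#

    k≤ : ∀ x → k x ≤ gap u S ω x + gap u S′ ω x
    k≤ x rewrite lookup-zipWith _xor_ x S S′ with H u x in hx | lookup S x in sx | lookup S′ x in sx′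
    ... | true  | true  | false = ≤-reflexive (sym (flip+flip true  false (ω x) ≡.refl))
    ... | true  | false | true  = ≤-reflexive (sym (flip+flip false true  (ω x) ≡.refl))
    ... | true  | true  | true  = ≤-respˡ (+-identityʳ 0#) (+-mono-≤ (flip-nonneg true (lower x) (upper x)) (flip-nonneg true (lower x) (upper x)))
    ... | true  | false | false = ≤-respˡ (+-identityʳ 0#) (+-mono-≤ (lower x) (lower x))
    ... | false | false | false = ≤-reflexive (sym (+-identityʳ 0#))
    ... | false | true  | _     = contradiction (≡.trans (≡.sym (S⊆u x sx)) hx) λ ()
    ... | false | false | true  = contradiction (≡.trans (≡.sym (S′⊆u x sx′)) hx) λ ()

    disagree : ∀ x → H u x ≡ true → lookup F x ≡ true → lookup S x xor lookup S′ x ≡ true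
    disagree x hx x∈F with lookup S x xor lookup S′ x in eq
    ... | true  = ≡.refl
    ... | false = contradiction 2<2 (<-irrefl refl)
      where
      k<  : k x < gap u S ω x + gap u S′ ω x
      k< rewrite lookup-zipWith _xor_ x S S′ | eq =
        <-respˡ-≈ (+-identityʳ 0#) (+-mono-<-≤ (gap-pos u S x hx x∈F) (gap-nonneg u S′ x))

      2<2 : 2 · 1# < 2 · 1#
      2<2 = ≤-<-trans (·1-mono 2≤△) (<-respˡ-≈ (sum-indicator (S △ S′))
        (<-respʳ-≈ (begin
          sum (λ y → gap u S ω y + gap u S′ ω y)   ≈⟨ ∑-distrib-+ (gap u S ω) (gap u S′ ω) ⟩
          distance u S ω + distance u S′ ω         ≈⟨ +-cong g≈1 (trans g′≈1 (sym (+-identityʳ 1#))) ⟩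
          2 · 1#                                   ∎)
          (sum-mono-< k≤ x k<)))

  tight-normals : ∀ u S S′ d → Supported d → Tight u S → Tight u S′ →
                  dot (normal u S) d ≈ 0# → dot (normal u S′) d ≈ 0#
  tight-normals u S S′ d supp tS tS′ flat with tight-disagree u S S′ tS tS′
  ... | inj₁ S≡S′ = trans (reflexive (≡.cong (λ T → dot (normal u T) d) (lookup-injective {p = S′} {S} (λ x → ≡.sym (S≡S′ x))))) flat
  ... | inj₂ differ = begin
    dot (normal u S′) d                       ≈⟨ sum-cong opposite ⟩
    sum (λ x → normal u S x * - d x)          ≈⟨ normal-neg u S d ⟩
    - dot (normal u S) d                      ≈⟨ -‿cong flat ⟩
    - 0#                                      ≈⟨ -0#≈0# ⟩
    0#                                        ∎
    where
    opposite : ∀ x → normal u S′ x * d x ≈ normal u S x * - d x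
    opposite x with lookup F x in fx
    ... | false = trans (trans (*-congˡ (supp x fx)) (zeroʳ _))
                    (sym (trans (*-congˡ (trans (-‿cong (supp x fx)) -0#≈0#)) (zeroʳ _)))
    ... | true with H u x in hx
    ...   | false = trans (zeroˡ _) (sym (zeroˡ _))
    ...   | true with differ x hx fx
    ...     | xor≡true with lookup S x | lookup S′ x
    ...       | true  | false = solve 1 (λ d → con (+ 1) :* d := (:- con (+ 1)) :* (:- d)) refl (d x)
    ...       | false | true  = solve 1 (λ d → (:- con (+ 1)) :* d := con (+ 1) :* (:- d)) refl (d x)

  side : Bool → ∀ {a} → Kind a → Bool
  side b (zero _)         = false
  side b (one _)          = true
  side b (fractional _ _) = b

  rounding : Bool → U → Subset ∣X∣
  rounding b u = tabulate (λ x → H u x ∧ side b (kind x))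

  lookup-rounding : ∀ b u x → lookup (rounding b u) x ≡ H u x ∧ side b (kind x)
  lookup-rounding b u x = lookup∘tabulate (λ x → H u x ∧ side b (kind x)) x

  rounding-within : ∀ b u → Within-row u (rounding b u)
  rounding-within b u x x∈ with ≡.trans (≡.sym (lookup-rounding b u x)) x∈
  ... | eq with H u x
  ...   | true = ≡.refl

  rounding-△ : ∀ u → rounding true u △ rounding false u ≡ row u ∩ F
  rounding-△ u = lookup-injective λ x →
    ≡.trans (lookup-zipWith _xor_ x (rounding true u) (rounding false u))
    (≡.trans (cong₂ _xor_ (lookup-rounding true u x) (lookup-rounding false u x))
    (≡.trans (sides (H u x) (kind x))
    (≡.sym (≡.trans (lookup-row∩ u x) (cong (H u x ∧_) (lookup∘tabulate (λ x → isFractional (kind x)) x))))))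
    where
    sides : ∀ h {a} (k : Kind a) → (h ∧ side true k) xor (h ∧ side false k) ≡ h ∧ isFractional k
    sides true  (zero _)         = ≡.refl
    sides true  (one _)          = ≡.refl
    sides true  (fractional _ _) = ≡.refl
    sides false _                = ≡.refl

  -- One of the two roundings of ω at u is odd, and it lies within distance
  -- less than 1 of ω if only one coordinate had to be rounded.
  degree≢1 : ∀ u → ∣ row u ∩ F ∣ ≢ 1
  degree≢1 u deg≡1 with singleton (row u ∩ F) deg≡1
  -- The two roundings differ exactly at the fractional neighbours of `u`. Here there is one, so
  -- their sizes have opposite parities.
  ... | a , a∈ , _ = one-odd (parity ∣ rounding true u ∣) (parity ∣ rounding false u ∣) ≡.refl ≡.refl
      (≡.trans (≡.sym (parity-△ (rounding true u) (rounding false u)))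
               (cong parity (≡.trans (cong ∣_∣ (rounding-△ u)) deg≡1)))
    where
    near : ∀ b → distance u (rounding b u) ω < 1#
    near b = <-respʳ-≈ (trans (sum-indicator (row u ∩ F)) (trans (reflexive (cong (_· 1#) deg≡1)) (+-identityʳ 1#)))
      (sum-mono-< gap≤ a gap<)
      where
      S = rounding b u

      gap≤ : ∀ x → gap u S ω x ≤ (if lookup (row u ∩ F) x then 1# else 0#)
      gap≤ x rewrite lookup-row∩ u x | lookup-rounding b u x
        | lookup∘tabulate (λ x → isFractional (kind x)) x with H u x | kind x
      ... | false | _                  = ≤-reflexive refl
      ... | true  | zero ω≈0           = ≤-reflexive ω≈0
      ... | true  | one ω≈1            = ≤-reflexive (flip-0 ω≈1)
      ... | true  | fractional 0<ω ω<1 = <⇒≤ (flip-<1 b 0<ω ω<1)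

      gap< : gap u S ω a < (if lookup (row u ∩ F) a then 1# else 0#)
      gap< with row∩F⁻ {u} {a} a∈
      ... | ha , fa rewrite a∈ | ha = let (0<ω , ω<1) = F-fractional a fa in flip-<1 (lookup S a) 0<ω ω<1

    far : ∀ b → parity ∣ rounding b u ∣ ≡ 1ℙ → ⊥
    far b odd = 1≤distance u (rounding b u) (rounding-within b u) odd (near b)

    one-odd : ∀ p q → parity ∣ rounding true u ∣ ≡ p → parity ∣ rounding false u ∣ ≡ q → p ℙ.+ q ≡ 1ℙ → ⊥
    one-odd 1ℙ _  odd _   _ = far true odd
    one-odd 0ℙ 1ℙ _   odd _ = far false odd

  untouched : ∀ u d → Supported d → (∀ x → H u x ≡ true → lookup F x ≡ true → ⊥) →
              ∀ S → dot (normal u S) d ≈ 0#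
  untouched u d supp none S = sum-zero pointwise
    where
    pointwise : ∀ x → normal u S x * d x ≈ 0#
    pointwise x with lookup F x in fx
    ... | false = trans (*-congˡ (supp x fx)) (zeroʳ _)
    ... | true with H u x in hx
    ...   | false = zeroˡ _
    ...   | true  = contradiction fx (none x hx)

  stretch : Point ℝ ∣X∣
  stretch x = if lookup F x then ω x + ω x - 1# else 0#

  -- If only two coordinates at u are fractional then a tight inequality at u
  -- reads ω x = ω y or ω x + ω y = 1, which is preserved by stretching ω
  -- away from ½.
  stretch-feasible : (∀ u → ∣ row u ∩ F ∣ ℕ.≤ 2) → Feasible stretch
  stretch-feasible deg≤2 = supported , flat
    where
    supported : Supported stretch
    supported x x∉F rewrite x∉F = refl

    flat : ∀ u S → Tight u S → dot (normal u S) stretch ≈ 0#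
    flat u S (S⊆u , odd , g≈1) = by-degree _ ≡.refl
      where
      -- If `S` disagreed with `ω` at an integral neighbour, that neighbour alone would contribute 1
      -- to the distance, and the fractional neighbour `x` would push it above 1, against tightness.
      integral-gap : ∀ x y → lookup (row u ∩ F) x ≡ true → H u y ≡ true → lookup F y ≡ false → gap u S ω y ≈ 0#
      integral-gap x y x∈ hy y∉F with flip-integral (lookup S y) (F-integral y y∉F)
      ... | inj₁ ≈0 rewrite hy = ≈0
      ... | inj₂ ≈1 = contradiction g≈1 λ g≈1 → <-irrefl (sym g≈1) 1<g
        where
        δ≤gap : ∀ z → 1# * δ y z ≤ gap u S ω z
        δ≤gap z with z ≟ y
        ... | yes ≡.refl rewrite hy = ≤-reflexive (trans (*-identityˡ 1#) (sym ≈1))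
        ... | no  _ = ≤-respˡ (sym (zeroʳ 1#)) (gap-nonneg u S z)

        x≢y : x ≢ y
        x≢y ≡.refl = contradiction (≡.trans (≡.sym (proj₂ (row∩F⁻ {u} {x} x∈))) y∉F) λ ()

        1<g : 1# < distance u S ω
        1<g = <-respˡ-≈ (sum-δ (λ _ → 1#) y) (sum-mono-< δ≤gap x
          (<-respˡ-≈ (sym (trans (*-congˡ (δ-≢ x≢y)) (zeroʳ 1#)))
            (let (hx , fx) = row∩F⁻ {u} {x} x∈ in gap-pos u S x hx fx)))

      k : X → Carrier
      k x = if lookup (row u ∩ F) x then 1# else 0#

      -- Each fractional neighbour contributes twice its gap minus 1, and integral neighbours
      -- contribute nothing. Summation gives twice the distance minus the fractional degree, which
      -- is 2 - 2 in the case where this is used.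
      pointwise : ∀ x₀ → lookup (row u ∩ F) x₀ ≡ true →
                  ∀ x → normal u S x * stretch x ≈ (1# + 1#) * gap u S ω x + (- 1#) * k x
      pointwise x₀ x₀∈ x with integral-gap x₀ x x₀∈
      ... | integral rewrite lookup-row∩ u x with H u x | lookup F x | lookup S x
      ...   | false | _     | _     = solve 1 (λ d → con (+ 0) :* d := con (+ 2) :* con (+ 0) :+ (:- con (+ 1)) :* con (+ 0)) refl _
      ...   | true  | true  | true  = solve 1 (λ w → (:- con (+ 1)) :* (w :+ w :- con (+ 1)) := con (+ 2) :* (con (+ 1) :- w) :+ (:- con (+ 1)) :* con (+ 1)) refl (ω x)
      ...   | true  | true  | false = solve 1 (λ w → con (+ 1) :* (w :+ w :- con (+ 1)) := con (+ 2) :* w :+ (:- con (+ 1)) :* con (+ 1)) refl (ω x)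
      ...   | true  | false | b     = trans (zeroʳ _) (sym (trans (+-congʳ (*-congˡ (integral ≡.refl ≡.refl)))
                                        (solve 0 (con (+ 2) :* con (+ 0) :+ (:- con (+ 1)) :* con (+ 0) := con (+ 0)) refl)))

      by-degree : ∀ k → ∣ row u ∩ F ∣ ≡ k → dot (normal u S) stretch ≈ 0#
      by-degree 0 eq = untouched u stretch supported
        (λ x hx fx → true⇒∣∣≢0 (row u ∩ F) x (row∩F {u} {x} hx fx) eq) S
      by-degree 1 eq = contradiction eq (degree≢1 u)
      by-degree (suc (suc (suc k))) eq = contradiction (≡.subst (ℕ._≤ 2) eq (deg≤2 u)) λ { (s≤s (s≤s ())) }
      by-degree 2 eq with ∣∣≢0⇒true (row u ∩ F) (λ ≡0 → contradiction (≡.trans (≡.sym eq) ≡0) λ ())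
      ... | x₀ , x₀∈ = begin
        dot (normal u S) stretch                                  ≈⟨ sum-cong (pointwise x₀ x₀∈) ⟩
        sum (λ x → (1# + 1#) * gap u S ω x + (- 1#) * k x)        ≈⟨ sum-linear (1# + 1#) (- 1#) (gap u S ω) k ⟩
        (1# + 1#) * distance u S ω + (- 1#) * sum k               ≈⟨ +-cong (*-congˡ g≈1) (*-congˡ (trans (sum-indicator (row u ∩ F)) (reflexive (cong (_· 1#) eq)))) ⟩
        (1# + 1#) * 1# + (- 1#) * (1# + (1# + 0#))                ≈⟨ solve 0 (con (+ 2) :* con (+ 1) :+ (:- con (+ 1)) :* (con (+ 1) :+ (con (+ 1) :+ con (+ 0))) := con (+ 0)) refl ⟩
        0#                                                        ∎

  degree≤2 : ∀ u → ∣ row u ∩ F ∣ ℕ.≤ 2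
  degree≤2 u₀ = ℕ.≮⇒≥ λ 2<deg → ¬¬-Fin (λ u → ¬¬-excluded-middle {A = ∃ (Tight u)}) λ tight? →
    underdetermined (λ u → equation u (tight? u)) touched F (touched<F degree≢1 u₀ 2<deg)
      λ (d , supp , (x , dx#0) , solves) →
        proj₂ (tight _ _) (rigid d (supp , λ u S tS → flat u (tight? u) d supp S tS (solves u)) x) dx#0
    where
    -- One tight set per check is enough, because `tight-normals` covers the others. A check without
    -- tight sets receives the trivial equation, so the number of equations is still bounded by the
    -- touched checks.
    equation : ∀ u → Dec (∃ (Tight u)) → X → Carrier
    equation u (yes (S , _)) = normal u S
    equation u (no _)        = λ _ → 0#

    flat : ∀ u (t? : Dec (∃ (Tight u))) d → Supported d → ∀ S → Tight u S →
           (lookup touched u ≡ true → dot (equation u t?) d ≈ 0#) → dot (normal u S) d ≈ 0#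
    flat u (no ¬t) d supp S tS solves = contradiction (S , tS) ¬t
    flat u (yes (S₀ , tS₀)) d supp S tS solves with ∣ row u ∩ F ∣ in eq
    ... | zero  = untouched u d supp (λ x hx fx → true⇒∣∣≢0 (row u ∩ F) x (row∩F {u} {x} hx fx) eq) S
    ... | suc k = tight-normals u S₀ S d supp tS₀ tS
      (solves (≡.trans (lookup∘tabulate (λ u → positive ∣ row u ∩ F ∣) u) (cong positive eq)))

  fractional≈½ : ∀ x → lookup F x ≡ true → ω x ≈ ½
  fractional≈½ x x∈F = ≈½ (begin
    ω x + ω x                    ≈⟨ solve 1 (λ w → w :+ w := (w :+ w :- con (+ 1)) :+ con (+ 1)) refl (ω x) ⟩
    ω x + ω x - 1# + 1#          ≈⟨ +-congʳ stretched ⟩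
    0# + 1#                      ≈⟨ +-identityˡ 1# ⟩
    1#                           ∎)
    where
    unfold : stretch x ≈ ω x + ω x - 1#
    unfold rewrite x∈F = refl

    stretched : ω x + ω x - 1# ≈ 0#
    stretched = trans (sym unfold) (rigid stretch (stretch-feasible degree≤2) x)

  degree≡2 : ∀ u x → H u x ≡ true → lookup F x ≡ true → ∣ row u ∩ F ∣ ≡ 2
  degree≡2 u x hx fx = exactly (true⇒∣∣≢0 (row u ∩ F) x (row∩F {u} {x} hx fx)) (degree≢1 u) (degree≤2 u)
    where
    exactly : ∀ {k} → k ≢ 0 → k ≢ 1 → k ℕ.≤ 2 → k ≡ 2
    exactly {0} ≢0 _ _ = contradiction ≡.refl ≢0
    exactly {1} _ ≢1 _ = contradiction ≡.refl ≢1
    exactly {2} _ _  _ = ≡.refl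
    exactly {suc (suc (suc k))} _ _ (s≤s (s≤s ()))

-- Finite 2-regular graphs

module CycleDecomposition {A : Set} {ℓ : Level} (G : Graph A ℓ) (_≡?_ : DecidableEquality A)
  {N : ℕ} (element : Fin N → A) (index : A → Fin N) (element-index : ∀ a → element (index a) ≡ a)
  (vertex? : ∀ v → Dec (Graph.Vertex G v)) (adj-sym : Symmetric (Graph.Adj G))
  (adj-irrefl : ∀ {v} → ¬ Graph.Adj G v v) (adj-vertex : ∀ {v w} → Graph.Adj G v w → Graph.Vertex G w)
  (regular : 2-Regular G)
  where

  open Graph G

  index-injective : ∀ {a b} → index a ≡ index b → a ≡ b
  index-injective eq = ≡.trans (≡.sym (element-index _)) (≡.trans (cong element eq) (element-index _))

  neighbour : ∀ v → Vertex v → ∃[ w ] Adj v w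
  neighbour v vx with regular v vx
  ... | f , _ , nbrs = f zero , Equivalence.from (nbrs (f zero)) (zero , ≡.refl)

  otherNeighbour : ∀ v → Vertex v → ∀ w → ∃[ z ] Adj v z × z ≢ w
  otherNeighbour v vx w with regular v vx
  ... | f , inj , nbrs with f zero ≡? w
  ...   | no  f₀≢w   = f zero , Equivalence.from (nbrs (f zero)) (zero , ≡.refl) , f₀≢w
  ...   | yes ≡.refl = f (suc zero) , Equivalence.from (nbrs _) (suc zero , ≡.refl) , λ f₁≡f₀ → contradiction (inj f₁≡f₀) λ ()

  no-third : ∀ {v a b w} → Adj v a → Adj v b → a ≢ b → Adj v w → w ≡ a ⊎ w ≡ b
  no-third {v} {a} {b} {w} va vb a≢b vw with regular v (adj-vertex (adj-sym va))
  ... | f , inj , nbrs with Equivalence.to (nbrs a) va | Equivalence.to (nbrs b) vb | Equivalence.to (nbrs w) vw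
  ...   | zero     , a≡ | zero     , b≡ | _             = contradiction (≡.trans a≡ (≡.sym b≡)) a≢b
  ...   | suc zero , a≡ | suc zero , b≡ | _             = contradiction (≡.trans a≡ (≡.sym b≡)) a≢b
  ...   | zero     , a≡ | suc zero , b≡ | zero     , w≡ = inj₁ (≡.trans w≡ (≡.sym a≡))
  ...   | zero     , a≡ | suc zero , b≡ | suc zero , w≡ = inj₂ (≡.trans w≡ (≡.sym b≡))
  ...   | suc zero , a≡ | zero     , b≡ | zero     , w≡ = inj₂ (≡.trans w≡ (≡.sym b≡))
  ...   | suc zero , a≡ | zero     , b≡ | suc zero , w≡ = inj₁ (≡.trans w≡ (≡.sym a≡))

  Closed : ∀ {q} → (A → Set q) → Set (q ⊔ ℓ)
  Closed Q = ∀ {v w} → Q v → Adj v w → Q w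

  -- Asking that every edge at a node of the cycle be a cycle edge makes the cycle a whole connected
  -- component, not just a cycle in the graph.
  record IsComponent (γ : SimpleCycle A) : Set ℓ where
    field
      edge⇒adj : ∀ {v w} → CycleEdge γ v w → Adj v w
      adj⇒edge : ∀ {v w} → OnCycle γ v → Adj v w → CycleEdge γ v w

    closed : Closed (OnCycle γ)
    closed on adj with adj⇒edge on adj
    ... | i , inj₁ (_ , w≡) = next γ i , w≡
    ... | i , inj₂ (w≡ , _) = i , w≡

    on⇒vertex : ∀ {v} → OnCycle γ v → Vertex v
    on⇒vertex (i , ≡.refl) = adj-vertex (adj-sym (edge⇒adj (i , inj₁ (≡.refl , ≡.refl))))

  -- The cycle traced by a walk that never turns back

  module Walk (start : A) (start-vertex : Vertex start) where

    -- A directed edge: leaving a vertex by its other edge requires remembering where the walk came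
    -- from.
    Dart : Set ℓ
    Dart = ∃[ v ] ∃[ w ] Adj v w

    turn : Dart → Dart
    turn (v , w , vw) with otherNeighbour w (adj-vertex vw) v
    ... | z , wz , _ = w , z , wz

    walk : ℕ → Dart
    walk zero    = start , neighbour start start-vertex
    walk (suc n) = turn (walk n)

    p : ℕ → A
    p n = proj₁ (walk n)

    adj : ∀ n → Adj (p n) (p (suc n))
    adj n = proj₂ (proj₂ (walk n))

    no-backtrack : ∀ n → p (2 ℕ.+ n) ≢ p n
    no-backtrack n = proj₂ (proj₂ (otherNeighbour (p (suc n)) (adj-vertex (adj n)) (p n)))

    DistinctBelow : ℕ → Set
    DistinctBelow n = ∀ {i j} → i ℕ.< j → j ℕ.< n → p i ≢ p j

    FirstRepeat : Set
    FirstRepeat = ∃[ L ] DistinctBelow L × ∃[ j ] j ℕ.< L × p L ≡ p j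

    search : ∀ n → DistinctBelow n ⊎ FirstRepeat
    search zero = inj₁ λ _ ()
    search (suc n) with search n
    ... | inj₂ found = inj₂ found
    ... | inj₁ distinct with ℕ.anyUpTo? (λ j → p n ≡? p j) n
    ...   | yes (j , j<n , pn≡pj) = inj₂ (n , distinct , j , j<n , pn≡pj)
    ...   | no  new = inj₁ distinct′
      where
      distinct′ : DistinctBelow (suc n)
      distinct′ {i} {j} i<j j<1+n pi≡pj with ℕ.m≤n⇒m<n∨m≡n (ℕ.s≤s⁻¹ j<1+n)
      ... | inj₁ j<n    = distinct i<j j<n pi≡pj
      ... | inj₂ ≡.refl = new (i , i<j , ≡.sym pi≡pj)

    firstRepeat : FirstRepeat
    firstRepeat with search (suc N)
    ... | inj₂ found = found
    ... | inj₁ distinct with pigeonhole (ℕ.n<1+n N) (λ i → index (p (toℕ i)))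
    ...   | i , j , i<j , eq = contradiction (index-injective eq) (distinct i<j (toℕ<n j))

    -- A first return to p (j + 1) would have to come through p j or p (j + 2),
    -- the only neighbours of p (j + 1), so the first repeated node is p 0.
    returns : ∀ L j → DistinctBelow L → j ℕ.< L → p L ≡ p j → j ≡ 0
    returns L       zero    _        _     _  = ≡.refl
    returns (suc L) (suc j) distinct j<L eq
      with no-third (adj-sym (adj j)) (adj (suc j)) (no-backtrack j ∘ ≡.sym) (subst (λ v → Adj v (p L)) eq (adj-sym (adj L)))
    ... | inj₁ pL≡pj = contradiction (≡.sym pL≡pj) (distinct (s<s⁻¹ j<L) (ℕ.n<1+n L))
    -- This repeats a node too early unless 2 + j ≥ `L`. Equality makes the last two steps a
    -- backtrack, and `L` equal to 1 + j makes the last step a loop.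
    ... | inj₂ pL≡p2+j with ℕ.<-cmp (2 ℕ.+ j) L
    ...   | tri< 2+j<L _ _ = contradiction (≡.sym pL≡p2+j) (distinct 2+j<L (ℕ.n<1+n L))
    ...   | tri≈ _ ≡.refl _ = contradiction eq (no-backtrack (suc j))
    ...   | tri> _ _ L<2+j with ℕ.≤-antisym (ℕ.s≤s⁻¹ L<2+j) (s<s⁻¹ j<L)
    ...     | ≡.refl = contradiction (subst (Adj (p L)) eq (adj L)) adj-irrefl

    module Closing (l : ℕ) (distinct : DistinctBelow (3 ℕ.+ l)) (closes : p (3 ℕ.+ l) ≡ p 0) where

      L : ℕ
      L = 3 ℕ.+ l

      node-inj : ∀ {i j : Fin L} → p (toℕ i) ≡ p (toℕ j) → i ≡ j
      node-inj {i} {j} eq with ℕ.<-cmp (toℕ i) (toℕ j)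
      ... | tri< i<j _ _ = contradiction eq (distinct i<j (toℕ<n j))
      ... | tri≈ _ i≡j _ = toℕ-injective i≡j
      ... | tri> _ _ j<i = contradiction (≡.sym eq) (distinct j<i (toℕ<n i))

      γ : SimpleCycle A
      γ = record { length-3 = l ; node = p ∘ toℕ ; node-injective = node-inj }

      node-next : ∀ i → node γ (next γ i) ≡ p (suc (toℕ i))
      node-next i with ℕ.m≤n⇒m<n∨m≡n (toℕ<n i)
      ... | inj₁ i+1<L = cong p (≡.trans (toℕ-fromℕ< (m%n<n (suc (toℕ i)) L)) (m<n⇒m%n≡m i+1<L))
      -- At the last index the successor wraps around to 0, and `closes` identifies `p 0` with
      -- `p L`.
      ... | inj₂ i+1≡L = ≡.trans (cong p (≡.trans (toℕ-fromℕ< (m%n<n (suc (toℕ i)) L))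
                           (≡.trans (cong (ℕ._% L) i+1≡L) (n%n≡0 L))))
                           (≡.trans (≡.sym closes) (cong p (≡.sym i+1≡L)))

      edge : ∀ k → k ℕ.< L → ∀ {v w} → v ≡ p k → w ≡ p (suc k) → CycleEdge γ v w × CycleEdge γ w v
      edge k k<L {v} {w} v≡ w≡ = (i , inj₁ (v≡i , w≡i)) , (i , inj₂ (v≡i , w≡i))
        where
        i = fromℕ< k<L
        v≡i : v ≡ p (toℕ i)
        v≡i = ≡.trans v≡ (cong p (≡.sym (toℕ-fromℕ< k<L)))
        w≡i : w ≡ node γ (next γ i)
        w≡i = ≡.trans w≡ (≡.trans (cong (p ∘ suc) (≡.sym (toℕ-fromℕ< k<L))) (≡.sym (node-next i)))

      edge-at : ∀ k → k ℕ.< L → ∀ {w} → Adj (p k) w → CycleEdge γ (p k) w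
      -- Node 0 has no predecessor on the walk; its second neighbour is the last node, because the
      -- walk closes there.
      edge-at zero _ {w} adj-w with no-third (adj 0) (subst (λ v → Adj v (p (2 ℕ.+ l))) closes (adj-sym (adj (2 ℕ.+ l))))
                                        (distinct (s<s z<s) (ℕ.n<1+n _)) adj-w
      ... | inj₁ w≡p₁ = proj₁ (edge 0 z<s ≡.refl w≡p₁)
      ... | inj₂ w≡   = proj₂ (edge (2 ℕ.+ l) (ℕ.n<1+n _) w≡ (≡.sym closes))
      edge-at (suc k) 1+k<L adj-w with no-third (adj-sym (adj k)) (adj (suc k)) (no-backtrack k ∘ ≡.sym) adj-w
      ... | inj₁ w≡pk   = proj₂ (edge k (ℕ.<-trans (ℕ.n<1+n k) 1+k<L) w≡pk ≡.refl)
      ... | inj₂ w≡p2+k = proj₁ (edge (suc k) 1+k<L ≡.refl w≡p2+k)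

      isComponent : IsComponent γ
      isComponent = record
        { edge⇒adj = λ
            { (i , inj₁ (≡.refl , ≡.refl)) → subst (Adj (p (toℕ i))) (≡.sym (node-next i)) (adj (toℕ i))
            ; (i , inj₂ (≡.refl , ≡.refl)) → adj-sym (subst (Adj (p (toℕ i))) (≡.sym (node-next i)) (adj (toℕ i))) }
        ; adj⇒edge = λ { (i , ≡.refl) → edge-at (toℕ i) (toℕ<n i) }
        }

      -- Every node is joined to `start` by walking backwards. With `Q` the nodes of another
      -- component, this shows that a component meeting `γ` contains `start`; a start not yet
      -- covered therefore gives a cycle disjoint from the earlier ones.
      connected : ∀ {q} {Q : A → Set q} → Closed Q → ∀ {v} → OnCycle γ v → Q v → Q start
      connected {Q = Q} closed (i , ≡.refl) = back (toℕ i)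
        where
        back : ∀ k → Q (p k) → Q start
        back zero    q = q
        back (suc k) q = back k (closed q (adj-sym (adj k)))

    Result : Set _
    Result = ∃[ γ ] IsComponent γ × OnCycle γ start × (∀ δ → IsComponent δ → ∀ {v} → OnCycle γ v → OnCycle δ v → OnCycle δ start)

    component : Result
    component with firstRepeat
    ... | L , distinct , j , j<L , eq with returns L j distinct j<L eq
    -- Lengths 1 and 2 would be a loop and a backtrack, which leaves at least the length 3 that a
    -- simple cycle needs.
    component | 1 , _ , _ , _ , eq | ≡.refl = contradiction (subst (Adj start) eq (adj 0)) adj-irrefl
    component | 2 , _ , _ , _ , eq | ≡.refl = contradiction eq (no-backtrack 0)
    component | suc (suc (suc l)) , distinct , _ , _ , eq | ≡.refl =
      γ , isComponent , (zero , ≡.refl) , λ δ comp → connected (IsComponent.closed comp)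
      where open Closing l distinct eq

  -- The invariant of a greedy construction: only `covers` refers to the list, so a node that is
  -- already covered, or is no vertex, leaves the other fields unchanged.
  record Family (vs : List A) : Set ℓ where
    field
      number     : ℕ
      cycle      : Fin number → SimpleCycle A
      components : ∀ i → IsComponent (cycle i)
      disjoint   : ∀ i j v → OnCycle (cycle i) v → OnCycle (cycle j) v → i ≡ j
      covers     : ∀ {v} → v ∈ vs → Vertex v → ∃[ i ] OnCycle (cycle i) v

  extend : ∀ {v vs} → (Vertex v → Family (v List.∷ vs)) → Family vs → Family (v List.∷ vs)
  extend {v} {vs} f fam with vertex? v
  ... | yes vx = f vx
  ... | no ¬vx = record
    { Family fam
    ; covers = λ { (here ≡.refl) vx → contradiction vx ¬vx ; (there ∈vs) → Family.covers fam ∈vs }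
    }

  family : ∀ vs → Family vs
  family List.[] = record
    { number = 0 ; cycle = λ () ; components = λ () ; disjoint = λ () ; covers = λ () }
  family (v List.∷ vs) = extend add fam
    where
    fam = family vs
    open Family fam

    on? : Dec (∃[ i ] OnCycle (cycle i) v)
    on? = any? λ i → any? λ k → v ≡? node (cycle i) k

    add : Vertex v → Family (v List.∷ vs)
    add vx with on?
    ... | yes on = record
      { Family fam
      ; covers = λ { (here ≡.refl) _ → on ; (there ∈vs) → covers ∈vs }
      }
    ... | no ¬on with Walk.component v vx
    ...   | γ , comp , on-γ , linked = record
      { number     = suc number
      ; cycle      = cycle′
      ; components = λ { zero → comp ; (suc i) → components i }
      ; disjoint   = disjoint′
      ; covers     = λ
          { (here ≡.refl) _  → zero , on-γ
          ; (there ∈vs)   vx → let (i , on) = covers ∈vs vx in suc i , on }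
      }
      where
      cycle′ : Fin (suc number) → SimpleCycle A
      cycle′ zero    = γ
      cycle′ (suc i) = cycle i

      disjoint′ : ∀ i j w → OnCycle (cycle′ i) w → OnCycle (cycle′ j) w → i ≡ j
      disjoint′ zero    zero    w _    _    = ≡.refl
      disjoint′ zero    (suc j) w on-i on-j = contradiction (j , linked (cycle j) (components j) on-i on-j) ¬on
      disjoint′ (suc i) zero    w on-i on-j = contradiction (i , linked (cycle i) (components i) on-j on-i) ¬on
      disjoint′ (suc i) (suc j) w on-i on-j = cong suc (disjoint i j w on-i on-j)

  disjointUnionOfCycles : IsDisjointUnionOfCycles G
  disjointUnionOfCycles = record
    { number   = number
    ; cycle    = cycle
    ; vertices = λ v → mk⇔ (covered v) (λ (i , on) → IsComponent.on⇒vertex (components i) on)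
    ; edges    = λ v w → mk⇔
        (λ vw → let (i , on) = covered v (adj-vertex (adj-sym vw)) in i , IsComponent.adj⇒edge (components i) on vw)
        (λ (i , vw) → IsComponent.edge⇒adj (components i) vw)
    ; disjoint = disjoint
    }
    where
    open Family (family (List.tabulate element))
    covered : ∀ v → Vertex v → ∃[ i ] OnCycle (cycle i) v
    covered v = covers (subst (_∈ List.tabulate element) (element-index v) (∈-tabulate⁺ (index v)))

-- The half-integral coordinates of a pseudocodeword

hasCardinality-2 : ∀ {A : Set} {ℓ} {S : Pred A ℓ} (a b : A) → a ≢ b → S a → S b →
                   (∀ {c} → S c → c ≡ a ⊎ c ≡ b) → HasCardinality S 2
hasCardinality-2 {A} {S = S} a b a≢b Sa Sb only = f , (λ {i} {j} → injective i j) , λ c → mk⇔ (to ∘ only) from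
  where
  f : Fin 2 → A
  f zero       = a
  f (suc zero) = b

  injective : ∀ i j → f i ≡ f j → i ≡ j
  injective zero       zero       _   = ≡.refl
  injective zero       (suc zero) a≡b = contradiction a≡b a≢b
  injective (suc zero) zero       b≡a = contradiction (≡.sym b≡a) a≢b
  injective (suc zero) (suc zero) _   = ≡.refl

  to : ∀ {c} → c ≡ a ⊎ c ≡ b → ∃[ i ] c ≡ f i
  to (inj₁ c≡a) = zero , c≡a
  to (inj₂ c≡b) = suc zero , c≡b

  from : ∀ {c} → ∃[ i ] c ≡ f i → S c
  from (zero     , ≡.refl) = Sa
  from (suc zero , ≡.refl) = Sb

module HalfIntegrality {c ℓ₁ ℓ₂} (ℝ : RealNumbers c ℓ₁ ℓ₂) (C : Code) (cc : IsCycleCode C)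
  (ω : Point ℝ (Code.∣X∣ C)) (ext : IsLPPseudocodeword ℝ C ω) where

  open Reals ℝ
  open Polytope ℝ C
  open Code C

  ¬¬kind : ∀ x → ¬ ¬ Kind (ω x)
  ¬¬kind x none = ¬¬-excluded-middle {A = 0# < ω x} λ
    { (no 0≮ω)  → none (zero (≤-antisym 0≮ω (lower x)))
    ; (yes 0<ω) → ¬¬-excluded-middle {A = ω x < 1#} λ
        { (no ω≮1)  → none (one (≤-antisym (upper x) ω≮1))
        ; (yes ω<1) → none (fractional 0<ω ω<1) } }
    where open FundamentalPolytope (proj₁ ext)

  ¬¬0½1 : ∀ x → ¬ ¬ Is0½1 ℝ (ω x)
  ¬¬0½1 x none = ¬¬-Fin ¬¬kind λ kind → none (from-kind kind)
    where
    from-kind : (∀ x → Kind (ω x)) → Is0½1 ℝ (ω x)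
    from-kind kind with lookup E.F x in eq
      where module E = Extreme ℝ C cc ω ext kind
    ... | true = inj₂ (inj₁ (Extreme.fractional≈½ ℝ C cc ω ext kind x eq))
    ... | false with Extreme.F-integral ℝ C cc ω ext kind x eq
    ...   | inj₁ ω≈0 = inj₁ ω≈0
    ...   | inj₂ ω≈1 = inj₂ (inj₂ ω≈1)

  -- 0, ½ and 1 are apart from each other, so cotransitivity finds out which
  -- of them the coordinate is.
  0½1-stable : ∀ {a h} → 0# < h → h < 1# → ¬ ¬ (a ≈ 0# ⊎ a ≈ h ⊎ a ≈ 1#) → a ≈ 0# ⊎ a ≈ h ⊎ a ≈ 1#
  0½1-stable {a} {h} 0<h h<1 ¬¬0h1 with <-cotrans 0<h a
  ... | inj₂ a<h = inj₁ (≈-stable λ a≉0 → ¬¬0h1 λ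
    { (inj₁ a≈0)        → a≉0 a≈0
    ; (inj₂ (inj₁ a≈h)) → <-irrefl a≈h a<h
    ; (inj₂ (inj₂ a≈1)) → <-irrefl a≈1 (<-trans a<h h<1) })
  ... | inj₁ 0<a with <-cotrans h<1 a
  ...   | inj₁ h<a = inj₂ (inj₂ (≈-stable λ a≉1 → ¬¬0h1 λ
    { (inj₁ a≈0)        → <-irrefl (sym a≈0) 0<a
    ; (inj₂ (inj₁ a≈h)) → <-irrefl (sym a≈h) h<a
    ; (inj₂ (inj₂ a≈1)) → a≉1 a≈1 }))
  ...   | inj₂ a<1 = inj₂ (inj₁ (≈-stable λ a≉h → ¬¬0h1 λ
    { (inj₁ a≈0)        → <-irrefl (sym a≈0) 0<a
    ; (inj₂ (inj₁ a≈h)) → a≉h a≈h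
    ; (inj₂ (inj₂ a≈1)) → <-irrefl a≈1 a<1 }))

  is0½1 : ∀ x → Is0½1 ℝ (ω x)
  is0½1 x = 0½1-stable 0<½ ½<1 (¬¬0½1 x)

  0½1⇒kind : ∀ {a} → Is0½1 ℝ a → Kind a
  0½1⇒kind (inj₁ a≈0)        = zero a≈0
  0½1⇒kind (inj₂ (inj₁ a≈½)) = fractional (<-respʳ-≈ (sym a≈½) 0<½) (<-respˡ-≈ (sym a≈½) ½<1)
  0½1⇒kind (inj₂ (inj₂ a≈1)) = one a≈1

  -- Half-integrality gives the classification outright. The neighbourhood enumerations and the
  -- cycles of Γ are data, so a doubly negated classification would not suffice for them.
  kind : ∀ x → Kind (ω x)
  kind x = 0½1⇒kind (is0½1 x)

-- The graph induced by the half-valued variables and their checks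

module HalfGraph {c ℓ₁ ℓ₂} (ℝ : RealNumbers c ℓ₁ ℓ₂) (C : Code) (cc : IsCycleCode C)
  (ω : Point ℝ (Code.∣X∣ C)) (ext : IsLPPseudocodeword ℝ C ω)
  (kind : ∀ x → Polytope.Kind ℝ C (ω x)) where

  open Reals ℝ
  open Polytope ℝ C
  open Code C
  open Extreme ℝ C cc ω ext kind

  ½⇒F : ∀ x → ω x ≈ ½ → lookup F x ≡ true
  ½⇒F x ω≈½ with lookup F x in eq
  ... | true  = ≡.refl
  ... | false with F-integral x eq
  ...   | inj₁ ω≈0 = contradiction 0<½ (<-irrefl (trans (sym ω≈0) ω≈½))
  ...   | inj₂ ω≈1 = contradiction ½<1 (<-irrefl (trans (sym ω≈½) ω≈1))

  -- Equality of reals is undecidable in general, but here it is equivalent to a Boolean entry of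
  -- `F`.
  half? : ∀ x → Dec (ω x ≈ ½)
  half? x = map′ (fractional≈½ x) (½⇒F x) (lookup F x Bool.≟ true)

  open Graph (Γ ℝ C ω)

  variable-vertex : ∀ {x} → ω x ≈ ½ → Vertex (inj₁ x)
  variable-vertex {x} ω≈½ = isNode , inj₁ (x , ≡.refl , ω≈½)

  check-vertex : ∀ {x u} → ω x ≈ ½ → H u x ≡ true → Vertex (inj₂ u)
  check-vertex {x} ω≈½ hx = isNode , inj₂ (inj₁ x , (x , ≡.refl , ω≈½) , x~u hx)

  variable-vertex⁻ : ∀ {x} → Vertex (inj₁ x) → ω x ≈ ½
  variable-vertex⁻ (_ , inj₁ (_ , ≡.refl , ω≈½)) = ω≈½
  -- Neighbours of variables are checks, so a variable can enter Γ only through its own value.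
  variable-vertex⁻ (_ , inj₂ (_ , (_ , () , _) , u~x _))

  check-vertex⁻ : ∀ {u} → Vertex (inj₂ u) → ∃[ x ] ω x ≈ ½ × H u x ≡ true
  check-vertex⁻ (_ , inj₂ (_ , (x , ≡.refl , ω≈½) , x~u hx)) = x , ω≈½ , hx

  edge : ∀ {x u} → ω x ≈ ½ → H u x ≡ true → Adj (inj₁ x) (inj₂ u)
  edge ω≈½ hx = proj₂ (variable-vertex ω≈½) , proj₂ (check-vertex ω≈½ hx) , x~u hx

  adj-sym : ∀ {v w} → Adj v w → Adj w v
  adj-sym (Wv , Ww , x~u hx) = Ww , Wv , u~x hx
  adj-sym (Wv , Ww , u~x hx) = Ww , Wv , x~u hx

  check-degree : ∀ u → ∣ row u ∩ F ∣ ≡ 2 → HasCardinality (neighborhood (Γ ℝ C ω) (inj₂ u)) 2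
  check-degree u deg≡2 with doubleton (row u ∩ F) deg≡2
  ... | a , b , a≢b , a∈ , b∈ , only = hasCardinality-2 (inj₁ a) (inj₁ b) (a≢b ∘ Sum.inj₁-injective)
      (incident a∈) (incident b∈) other
    where
    incident : ∀ {y} → lookup (row u ∩ F) y ≡ true → Adj (inj₂ u) (inj₁ y)
    incident {y} y∈ = let (hy , fy) = row∩F⁻ {u} {y} y∈ in adj-sym (edge (fractional≈½ y fy) hy)
    other : ∀ {w} → Adj (inj₂ u) w → w ≡ inj₁ a ⊎ w ≡ inj₁ b
    other (_ , Wy , u~x {x = y} hy) with only y (row∩F {u} {y} hy (½⇒F y (variable-vertex⁻ (isNode , Wy))))
    ... | inj₁ ≡.refl = inj₁ ≡.refl
    ... | inj₂ ≡.refl = inj₂ ≡.refl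

  adj-irrefl : ∀ {v} → ¬ Adj v v
  adj-irrefl (_ , _ , ())

  adj-vertex : ∀ {v w} → Adj v w → Vertex w
  adj-vertex (_ , Ww , _) = isNode , Ww

  -- A half-valued variable keeps both its edges, since its checks lie in the neighbourhood of the
  -- half-valued variables. A check keeps just the edges to half-valued variables, and these are its
  -- fractional ones.
  regular : 2-Regular (Γ ℝ C ω)
  regular (inj₁ x) vx with doubleton (column x) (cc x)
  ... | a , b , a≢b , ha , hb , only = hasCardinality-2 (inj₂ a) (inj₂ b) (a≢b ∘ Sum.inj₂-injective)
      (edge ω≈½ (column⁻ ha)) (edge ω≈½ (column⁻ hb)) other
    where
    ω≈½ = variable-vertex⁻ vx
    column⁻ : ∀ {u} → lookup (column x) u ≡ true → H u x ≡ true
    column⁻ {u} = ≡.trans (≡.sym (lookup∘tabulate (λ u → H u x) u))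
    other : ∀ {w} → Adj (inj₁ x) w → w ≡ inj₂ a ⊎ w ≡ inj₂ b
    other (_ , _ , x~u {u = u} hx) with only u (≡.trans (lookup∘tabulate (λ u → H u x) u) hx)
    ... | inj₁ ≡.refl = inj₁ ≡.refl
    ... | inj₂ ≡.refl = inj₂ ≡.refl
  regular (inj₂ u) vu = let (x , ω≈½ , hx) = check-vertex⁻ vu in
    check-degree u (degree≡2 u x hx (½⇒F x ω≈½))

  vertex? : ∀ v → Dec (Vertex v)
  vertex? (inj₁ x) = map′ variable-vertex variable-vertex⁻ (half? x)
  vertex? (inj₂ u) = map′ (λ (x , ω≈½ , hx) → check-vertex ω≈½ hx) check-vertex⁻
                          (any? λ x → half? x ×-dec (H u x Bool.≟ true))

  union : IsDisjointUnionOfCycles (Γ ℝ C ω)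
  union = disjointUnionOfCycles
    where
    open CycleDecomposition (Γ ℝ C ω) (Sum.≡-dec _≟_ _≟_)
      (splitAt ∣X∣) (join ∣X∣ ∣U∣) (splitAt-join ∣X∣ ∣U∣) vertex? adj-sym
      adj-irrefl adj-vertex regular

mainTheorem1 : ∀ {c ℓ₁ ℓ₂} (ℝ : RealNumbers c ℓ₁ ℓ₂) (C : Code) →
    IsCycleCode C →
    (ω : Point ℝ (Code.∣X∣ C)) →
    IsLPPseudocodeword ℝ C ω →
    (∀ x → Is0½1 ℝ (ω x))
    × 2-Regular (Γ ℝ C ω)
    × IsDisjointUnionOfCycles (Γ ℝ C ω)
mainTheorem1 ℝ C cc ω ext = is0½1 , regular , union
  where
  open HalfIntegrality ℝ C cc ω ext
  open HalfGraph ℝ C cc ω ext kind
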